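{- Let $k \geq 2$ be an integer. Then every finite simple graph $G$ with $\frac{1}{k}|V(G)| = \gamma \geq \frac{5}{2}$ and $\frac{1}{k^2}|E(G)| > \frac{19}{12}(\gamma-1)$ contains a $(k+1)$-connected subgraph. Equivalently, if $n = |V(G)| \geq \frac{5k}{2}$ and $|E(G)| > \frac{19}{12}k(n-k)$, then $G$ contains a $(k+1)$-connected subgraph.
   Context: All graphs are finite, undirected and simple. A graph $H$ is called $(k+1)$-connected if $|V(H)| \geq k+2$ and for every set $S \subseteq V(H)$ with $|S| = k$, the graph $H - S$ (obtained by deleting the vertices of $S$) is connected and has at least two vertices. A subgraph of $G$ is any graph whose vertex set and edge set are subsets of those of $G$. -}

module Defs where

open import Data.Nat using (ℕ; _<_; _≤_)
open import Data.Nat.Properties using (_<?_)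
open import Data.Bool using (Bool; true; false; T)
open import Data.Bool.Properties using (T?)
open import Data.Fin using (Fin; toℕ)
open import Data.Fin.Subset using (Subset; _∈_; _⊆_; _─_; ∣_∣)
open import Data.List using (List; length; filter; cartesianProduct; allFin)
open import Data.Product using (_×_; _,_)
open import Relation.Nullary.Decidable using (_×-dec_)
open import Relation.Binary.PropositionalEquality using (_≡_)

record Graph (n : ℕ) : Set where
  field
    adj    : Fin n → Fin n → Bool
    sym    : ∀ i j → adj i j ≡ adj j i
    irrefl : ∀ i → adj i i ≡ false
open Graph public

edgeCount : ∀ {n} → Graph n → ℕ
edgeCount {n} G =
  length (filter (λ p → (toℕ (Data.Product.proj₁ p) <? toℕ (Data.Product.proj₂ p))
                         ×-dec T? (adj G (Data.Product.proj₁ p) (Data.Product.proj₂ p)))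
                 (cartesianProduct (allFin n) (allFin n)))

record Subgraph {n : ℕ} (G : Graph n) : Set where
  field
    verts     : Subset n
    edge      : Fin n → Fin n → Bool
    edge-sym  : ∀ i j → edge i j ≡ edge j i
    edge-sub  : ∀ i j → edge i j ≡ true → adj G i j ≡ true
    edge-ends : ∀ i j → edge i j ≡ true → (i ∈ verts) × (j ∈ verts)
open Subgraph public

data Walk {n : ℕ} (W : Subset n) (E : Fin n → Fin n → Bool) : Fin n → Fin n → Set where
  here : ∀ {u} → u ∈ W → Walk W E u u
  step : ∀ {u v w} → u ∈ W → E u v ≡ true → Walk W E v w → Walk W E u w

Connected : ∀ {n} → Subset n → (Fin n → Fin n → Bool) → Set
Connected W E = ∀ u v → u ∈ W → v ∈ W → Walk W E u v

SuccConnected : ∀ {n} {G : Graph n} → ℕ → Subgraph G → Set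
SuccConnected k H =
  (Data.Nat._+_ k 2 ≤ ∣ verts H ∣) ×
  (∀ (S : Subset _) → S ⊆ verts H → ∣ S ∣ ≡ k →
     Connected (verts H ─ S) (edge H) × (2 ≤ ∣ verts H ─ S ∣))

{-# OPTIONS --safe #-}
module Submission where

-- Suppose every U with ∣U∣ ≥ k + 2 has a separation U = A ⊎ S ⊎ B with ∣S∣ = k and no edges between A
-- and B; put x = ∣U∣ − k.  Counting ordered pairs, the claim is 6 e(U,U) ≤ 19 k x when 2x ≥ 3k.
-- Keeping the larger side and counting only the pairs A × B gives Matula's bound 3 ē(U,U) ≥ 2x²,
-- which settles x ≤ 2k.  For x > 2k, a vertex of degree < 3k/2 may be deleted, so suppose there is
-- none.  Then a side B with k + β vertices misses at least kβ pairs: ē(B,B) + 2 ē(B,S) ≥ kβ.  With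
-- ∣A∣ ≥ ∣B∣, the pairs meeting B are bounded by this, or by induction on B ∪ S if 2∣B∣ ≥ 3k, and
-- the pairs inside A ∪ S by induction if 2∣A∣ ≥ 3k and by Matula's bound otherwise.

open import Defs renaming (sym to adj-sym; irrefl to adj-irrefl)
open import Data.Bool using (true; false; _∧_; if_then_else_; _≟_)
import Data.Bool as Bool
open import Data.Bool.Properties using (T?; ∧-comm; ∧-conicalˡ; ∧-conicalʳ; ¬-not)
open import Data.Fin using (Fin; zero; suc; toℕ)
open import Data.Fin.Properties using (any?; toℕ-injective)
open import Data.Fin.Subset using (Subset; inside; outside; _∈_; _⊆_; _─_; ∣_∣; ⊤; ⁅_⁆)
open import Data.Fin.Subset.Properties using (drop-∷-⊆; x∈⁅y⁆⇒x≡y; ∣⁅x⁆∣≡1; ∣⊤∣≡n; _∈?_; _⊆?_)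
open import Data.List using (length; filter; cartesianProduct; allFin; tabulate; map; _++_; []; _∷_)
open import Data.List.Properties using (length-++; filter-++)
open import Data.Nat using (ℕ; zero; suc; _+_; _*_; _∸_; _≤_; _<_; z≤n; s≤s; s≤s⁻¹)
open import Data.Nat.Properties hiding (_≟_)
import Data.Nat.Properties as ℕ
open import Data.Nat.Tactic.RingSolver using (solve-∀)
open import Data.Product using (Σ; ∃; _×_; _,_; proj₁; proj₂)
open import Data.Sum using (_⊎_; inj₁; inj₂; [_,_]′)
open import Data.Vec using (lookup; []; _∷_; here; there)
open import Data.Vec.Properties using ([]=⇒lookup; lookup⇒[]=)
open import Function using (_∘_)
open import Relation.Binary using (tri<; tri≈; tri>)
open import Relation.Binary.PropositionalEquality
open import Relation.Nullary using (¬_; Dec; yes; no; contradiction; does)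
open import Relation.Nullary.Decidable using (_×-dec_; dec-true; dec-false)
open import Relation.Unary using (Decidable)

-- The constant 19 comes from Matula's bound, which gives 6 e(U,U) ≤ 6(k + x)² - 4x². Subtracting
-- 19kx from the right side leaves (2x - 3k)(x - 2k), so the estimate is exactly tight at x = 3k/2
-- and x = 2k, and beyond 2k an induction is needed. The obstacle is the smaller side B. With b =
-- ∣B∣ below 3k/2, the induction hypothesis says nothing about B ∪ S, while the trivial count b² +
-- 2bk of the pairs meeting B stays within 19kb/6 only for b ≤ 7k/6. The kβ non-edges close this
-- gap. They come from a second separation, inside B ∪ S. It cannot be applied to all of S, since
-- one of its sides might then lie within S, and non-edges inside S are not charged to B. So the
-- vertices of S with at least β non-neighbours in B are set aside, each paying β. A remaining
-- vertex has fewer, so it cannot be cut off from the vertices of B outside the new separator, of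
-- which there are at least β.

private variable
  n : ℕ
  p q r s t : Subset n

≤-by : ∀ {m o} d → m + d ≡ o → m ≤ o
≤-by {m} d eq = subst (m ≤_) eq (m≤m+n m d)

-- Disjoint unions of vertex sets.

-- Split p q r: p is the disjoint union of q and r.
data Split : Subset n → Subset n → Subset n → Set where
  []    : Split [] [] []
  left  : Split p q r → Split (inside ∷ p) (inside ∷ q) (outside ∷ r)
  right : Split p q r → Split (inside ∷ p) (outside ∷ q) (inside ∷ r)
  none  : Split p q r → Split (outside ∷ p) (outside ∷ q) (outside ∷ r)

split-comm : Split p q r → Split p r q
split-comm []        = []
split-comm (left d)  = right (split-comm d)
split-comm (right d) = left (split-comm d)
split-comm (none d)  = none (split-comm d)

∈-splitˡ : Split p q r → q ⊆ p
∈-splitˡ (left d)  here      = here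
∈-splitˡ (left d)  (there m) = there (∈-splitˡ d m)
∈-splitˡ (right d) (there m) = there (∈-splitˡ d m)
∈-splitˡ (none d)  (there m) = there (∈-splitˡ d m)

∈-splitʳ : Split p q r → r ⊆ p
∈-splitʳ d = ∈-splitˡ (split-comm d)

∈-split⁻ : ∀ {i} → Split p q r → i ∈ p → i ∈ q ⊎ i ∈ r
∈-split⁻ (left d)  here      = inj₁ here
∈-split⁻ (right d) here      = inj₂ here
∈-split⁻ (left d)  (there m) = [ inj₁ ∘ there , inj₂ ∘ there ]′ (∈-split⁻ d m)
∈-split⁻ (right d) (there m) = [ inj₁ ∘ there , inj₂ ∘ there ]′ (∈-split⁻ d m)
∈-split⁻ (none d)  (there m) = [ inj₁ ∘ there , inj₂ ∘ there ]′ (∈-split⁻ d m)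

∣∣-split : Split p q r → ∣ p ∣ ≡ ∣ q ∣ + ∣ r ∣
∣∣-split []            = refl
∣∣-split (left d)      = cong suc (∣∣-split d)
∣∣-split (right {q = q} {r = r} d) = trans (cong suc (∣∣-split d)) (sym (+-suc ∣ q ∣ ∣ r ∣))
∣∣-split (none d)      = ∣∣-split d

split-⊆ : ∀ (p q : Subset n) → q ⊆ p → Split p q (p ─ q)
split-⊆ []            []            q⊆p = []
split-⊆ (inside ∷ p)  (inside ∷ q)  q⊆p = left (split-⊆ p q (drop-∷-⊆ q⊆p))
split-⊆ (inside ∷ p)  (outside ∷ q) q⊆p = right (split-⊆ p q (drop-∷-⊆ q⊆p))
split-⊆ (outside ∷ p) (outside ∷ q) q⊆p = none (split-⊆ p q (drop-∷-⊆ q⊆p))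
split-⊆ (outside ∷ p) (inside ∷ q)  q⊆p with () ← q⊆p here

split-one : ∀ {i} → i ∈ p → Split p ⁅ i ⁆ (p ─ ⁅ i ⁆)
split-one {p = p} {i} i∈p = split-⊆ p ⁅ i ⁆ λ m → subst (_∈ p) (sym (x∈⁅y⁆⇒x≡y i m)) i∈p

split-assoc : Split p q r → Split r s t → ∃ λ u → Split p u t × Split u q s
split-assoc []        []         = [] , [] , []
split-assoc (left d)  (none d′)  = let u , a , b = split-assoc d d′ in inside ∷ u , left a , left b
split-assoc (right d) (left d′)  = let u , a , b = split-assoc d d′ in inside ∷ u , left a , right b
split-assoc (right d) (right d′) = let u , a , b = split-assoc d d′ in outside ∷ u , right a , none b
split-assoc (none d)  (none d′)  = let u , a , b = split-assoc d d′ in outside ∷ u , none a , none b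

-- The two-by-two table of intersections of two splittings of one set: rows add up to the parts of
-- the first, columns to the parts of the second. It serves to cut B and part of S by a second
-- separation.
record Refinement {n} (q r s t : Subset n) : Set where
  constructor refinement
  field
    {qs qt rs rt} : Subset n
    splitᵠ : Split q qs qt
    splitʳ : Split r rs rt
    splitˢ : Split s qs rs
    splitᵗ : Split t qt rt

refine : Split p q r → Split p s t → Refinement q r s t
refine []        []        = refinement [] [] [] []
refine (left d)  (left d′)  with refinement a b c e ← refine d d′ = refinement (left a) (none b) (left c) (none e)
refine (left d)  (right d′) with refinement a b c e ← refine d d′ = refinement (right a) (none b) (none c) (left e)
refine (right d) (left d′)  with refinement a b c e ← refine d d′ = refinement (none a) (left b) (right c) (none e)
refine (right d) (right d′) with refinement a b c e ← refine d d′ = refinement (none a) (right b) (none c) (right e)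
refine (none d)  (none d′)  with refinement a b c e ← refine d d′ = refinement (none a) (none b) (none c) (none e)

split-by : ∀ {P : Fin n → Set} → Decidable P → (p : Subset n) →
           ∃ λ q → ∃ λ r → Split p q r × (∀ {i} → i ∈ q → P i) × (∀ {i} → i ∈ r → ¬ P i)
split-by P? [] = [] , [] , [] , (λ ()) , (λ ())
split-by P? (outside ∷ p) with q , r , d , yq , nr ← split-by (P? ∘ suc) p =
  _ , _ , none d , (λ { (there m) → yq m }) , (λ { (there m) → nr m })
split-by P? (inside ∷ p) with q , r , d , yq , nr ← split-by (P? ∘ suc) p | P? zero
... | yes y = _ , _ , left d , (λ { here → y ; (there m) → yq m }) , (λ { (there m) → nr m })
... | no  y = _ , _ , right d , (λ { (there m) → yq m }) , (λ { here → y ; (there m) → nr m })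

nonempty : 1 ≤ ∣ p ∣ → ∃ λ i → i ∈ p
nonempty {p = inside ∷ p}  _ = zero , here
nonempty {p = outside ∷ p} l = let i , m = nonempty l in suc i , there m

0<∣p∣ : ∀ {i} → i ∈ p → 1 ≤ ∣ p ∣
0<∣p∣ here = s≤s z≤n
0<∣p∣ {p = inside ∷ p}  (there m) = s≤s z≤n
0<∣p∣ {p = outside ∷ p} (there m) = 0<∣p∣ m

-- Sums and weighted pair counts over subsets.

∑ : Subset n → (Fin n → ℕ) → ℕ
∑ []            f = 0
∑ (inside ∷ p)  f = f zero + ∑ p (f ∘ suc)
∑ (outside ∷ p) f = ∑ p (f ∘ suc)

∑-split : Split p q r → ∀ f → ∑ p f ≡ ∑ q f + ∑ r f
∑-split [] f = refl
∑-split (left d) f = trans (cong (f zero +_) (∑-split d (f ∘ suc))) (sym (+-assoc (f zero) _ _))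
∑-split (right {q = q} {r = r} d) f = trans (cong (f zero +_) (∑-split d (f ∘ suc)))
  (swap (f zero) (∑ q (f ∘ suc)) (∑ r (f ∘ suc)))
  where swap : ∀ a b c → a + (b + c) ≡ b + (a + c)
        swap = solve-∀
∑-split (none d) f = ∑-split d (f ∘ suc)

∑-mono : ∀ {f g : Fin n → ℕ} → (∀ {i} → i ∈ p → f i ≤ g i) → ∑ p f ≤ ∑ p g
∑-mono {p = []} h = z≤n
∑-mono {p = inside ∷ p} h = +-mono-≤ (h here) (∑-mono {p = p} (h ∘ there))
∑-mono {p = outside ∷ p} h = ∑-mono {p = p} (h ∘ there)

∑-cong : ∀ {f g : Fin n → ℕ} → (∀ {i} → i ∈ p → f i ≡ g i) → ∑ p f ≡ ∑ p g
∑-cong {p = p} h = ≤-antisym (∑-mono {p = p} (≤-reflexive ∘ h)) (∑-mono {p = p} (≤-reflexive ∘ sym ∘ h))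

∑-const : ∀ (p : Subset n) c → ∑ p (λ _ → c) ≡ ∣ p ∣ * c
∑-const []            c = refl
∑-const (inside ∷ p)  c = cong (c +_) (∑-const p c)
∑-const (outside ∷ p) c = ∑-const p c

∑-+ : ∀ (p : Subset n) f g → ∑ p (λ i → f i + g i) ≡ ∑ p f + ∑ p g
∑-+ []            f g = refl
∑-+ (inside ∷ p)  f g = trans (cong (f zero + g zero +_) (∑-+ p (f ∘ suc) (g ∘ suc)))
  (swap (f zero) (g zero) (∑ p (f ∘ suc)) (∑ p (g ∘ suc)))
  where swap : ∀ a b c d → a + b + (c + d) ≡ a + c + (b + d)
        swap = solve-∀
∑-+ (outside ∷ p) f g = ∑-+ p (f ∘ suc) (g ∘ suc)

∑-one : ∀ (i : Fin n) f → ∑ ⁅ i ⁆ f ≡ f i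
∑-one i f = begin
  ∑ ⁅ i ⁆ f            ≡⟨ ∑-cong {p = ⁅ i ⁆} (λ m → cong f (x∈⁅y⁆⇒x≡y i m)) ⟩
  ∑ ⁅ i ⁆ (λ _ → f i)  ≡⟨ ∑-const ⁅ i ⁆ (f i) ⟩
  ∣ ⁅ i ⁆ ∣ * f i      ≡⟨ cong (_* f i) (∣⁅x⁆∣≡1 i) ⟩
  1 * f i              ≡⟨ *-identityˡ (f i) ⟩
  f i                  ∎
  where open ≡-Reasoning

pairs : (Fin n → Fin n → ℕ) → Subset n → Subset n → ℕ
pairs w p q = ∑ p (λ i → ∑ q (w i))

∑-swap : ∀ {m} (w : Fin m → Fin n → ℕ) (p : Subset m) (q : Subset n) →
         ∑ p (λ i → ∑ q (w i)) ≡ ∑ q (λ j → ∑ p (λ i → w i j))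
∑-swap w []            q = sym (trans (∑-const q 0) (*-zeroʳ ∣ q ∣))
∑-swap w (inside ∷ p)  q = trans (cong (∑ q (w zero) +_) (∑-swap (w ∘ suc) p q))
                                 (sym (∑-+ q (w zero) _))
∑-swap w (outside ∷ p) q = ∑-swap (w ∘ suc) p q

module _ (w : Fin n → Fin n → ℕ) where

  pairs-splitˡ : Split p q r → ∀ s → pairs w p s ≡ pairs w q s + pairs w r s
  pairs-splitˡ d s = ∑-split d _

  pairs-splitʳ : Split p q r → ∀ s → pairs w s p ≡ pairs w s q + pairs w s r
  pairs-splitʳ d s = trans (∑-cong {p = s} (λ _ → ∑-split d _)) (∑-+ s _ _)

  pairs-monoˡ : Split p q r → ∀ s → pairs w q s ≤ pairs w p s
  pairs-monoˡ d s = ≤-by _ (sym (pairs-splitˡ d s))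

  pairs-monoʳ : Split p q r → ∀ s → pairs w s q ≤ pairs w s p
  pairs-monoʳ d s = ≤-by _ (sym (pairs-splitʳ d s))

  module _ (w-sym : ∀ i j → w i j ≡ w j i) where

    pairs-comm : ∀ p q → pairs w p q ≡ pairs w q p
    pairs-comm p q = trans (∑-swap w p q) (∑-cong {p = q} λ _ → ∑-cong {p = p} λ _ → w-sym _ _)

    pairs-square : Split p q r → pairs w p p ≡ pairs w q q + 2 * pairs w q r + pairs w r r
    pairs-square {p = p} {q} {r} d = begin
      pairs w p p                 ≡⟨ pairs-splitˡ d p ⟩
      pairs w q p + pairs w r p   ≡⟨ cong₂ _+_ (pairs-splitʳ d q) (pairs-splitʳ d r) ⟩
      pairs w q q + pairs w q r + (pairs w r q + pairs w r r)
        ≡⟨ cong (λ x → pairs w q q + pairs w q r + (x + pairs w r r)) (pairs-comm r q) ⟩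
      pairs w q q + pairs w q r + (pairs w q r + pairs w r r)
        ≡⟨ collect (pairs w q q) (pairs w q r) (pairs w r r) ⟩
      pairs w q q + 2 * pairs w q r + pairs w r r ∎
      where
      open ≡-Reasoning
      collect : ∀ a b c → a + b + (b + c) ≡ a + 2 * b + c
      collect = solve-∀

∑-member : ∀ {i} → i ∈ p → ∀ f → f i ≤ ∑ p f
∑-member {p = p} {i} m f = begin
  f i                             ≡⟨ ∑-one i f ⟨
  ∑ ⁅ i ⁆ f                       ≤⟨ m≤m+n _ (∑ (p ─ ⁅ i ⁆) f) ⟩
  ∑ ⁅ i ⁆ f + ∑ (p ─ ⁅ i ⁆) f     ≡⟨ ∑-split (split-one m) f ⟨
  ∑ p f                           ∎
  where open ≤-Reasoning

∑-monoˢ : Split p q r → ∀ f → ∑ q f ≤ ∑ p f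
∑-monoˢ d f = ≤-by _ (sym (∑-split d f))

empty⇒∉ : ∀ {i} → ∣ p ∣ ≡ 0 → ¬ (i ∈ p)
empty⇒∉ e m with () ← subst (1 ≤_) e (0<∣p∣ m)

-- Finite search.

-- Q need not be the negation of P; it is whatever evidence a failed test returns. This keeps the
-- argument constructive: either a subgraph is found, or every large set comes with a separation.
search-Fin : ∀ {n} {P Q : Fin n → Set} → (∀ i → P i ⊎ Q i) → ∃ P ⊎ (∀ i → Q i)
search-Fin {zero}  h = inj₂ λ ()
search-Fin {suc n} h with h zero | search-Fin (h ∘ suc)
... | inj₁ p | _            = inj₁ (zero , p)
... | inj₂ _ | inj₁ (i , p) = inj₁ (suc i , p)
... | inj₂ q | inj₂ qs      = inj₂ λ { zero → q ; (suc i) → qs i }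

search-Subset : ∀ {n} {P Q : Subset n → Set} → (∀ p → P p ⊎ Q p) → ∃ P ⊎ (∀ p → Q p)
search-Subset {zero} h with h []
... | inj₁ p = inj₁ ([] , p)
... | inj₂ q = inj₂ λ { [] → q }
search-Subset {suc n} h with search-Subset (h ∘ (inside ∷_)) | search-Subset (h ∘ (outside ∷_))
... | inj₁ (p , x) | _            = inj₁ (_ , x)
... | inj₂ _       | inj₁ (p , x) = inj₁ (_ , x)
... | inj₂ qs      | inj₂ qs′     = inj₂ λ { (inside ∷ p) → qs p ; (outside ∷ p) → qs′ p }

-- Lengths of filtered lists as sums.

length-filter-map : ∀ {A B : Set} {P : B → Set} (P? : Decidable P) (f : A → B) xs →
                    length (filter P? (map f xs)) ≡ length (filter (P? ∘ f) xs)
length-filter-map P? f [] = refl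
length-filter-map P? f (x ∷ xs) with does (P? (f x))
... | true  = cong suc (length-filter-map P? f xs)
... | false = length-filter-map P? f xs

length-filter-tabulate : ∀ {n} {A : Set} {P : A → Set} (P? : Decidable P) (f : Fin n → A) →
  length (filter P? (tabulate f)) ≡ ∑ ⊤ (λ i → if does (P? (f i)) then 1 else 0)
length-filter-tabulate {zero}  P? f = refl
length-filter-tabulate {suc n} P? f with does (P? (f zero))
... | true  = cong suc (length-filter-tabulate P? (f ∘ suc))
... | false = length-filter-tabulate P? (f ∘ suc)

length-filter-product : ∀ {n} {A B : Set} {P : A × B → Set} (P? : Decidable P) (f : Fin n → A) ys →
  length (filter P? (cartesianProduct (tabulate f) ys)) ≡ ∑ ⊤ (λ i → length (filter (P? ∘ (f i ,_)) ys))
length-filter-product {zero}  P? f ys = refl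
length-filter-product {suc n} P? f ys = begin
  length (filter P? (map (f zero ,_) ys ++ rest))               ≡⟨ cong length (filter-++ P? (map (f zero ,_) ys) rest) ⟩
  length (filter P? (map (f zero ,_) ys) ++ filter P? rest)     ≡⟨ length-++ (filter P? (map (f zero ,_) ys)) ⟩
  length (filter P? (map (f zero ,_) ys)) + length (filter P? rest)
    ≡⟨ cong₂ _+_ (length-filter-map P? (f zero ,_) ys) (length-filter-product P? (f ∘ suc) ys) ⟩
  ∑ ⊤ (λ i → length (filter (P? ∘ (f i ,_)) ys))                ∎
  where
  open ≡-Reasoning
  rest = cartesianProduct (tabulate (f ∘ suc)) ys

-- Polynomial inequalities.

-- For a factor c, the inequality c(a + b)² ≤ ca² + 2ab holds for all b ≤ a exactly when 3c ≤ 2, the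
-- case a = b being decisive. This is the origin of 2/3.
matula-step : ∀ a b {N N′} → b ≤ a → 2 * (a * a) ≤ 3 * N → N + 2 * (a * b) ≤ N′ →
              2 * ((a + b) * (a + b)) ≤ 3 * N′
matula-step a b {N} {N′} b≤a h N≤ with c , refl ← m≤n⇒∃[o]m+o≡n b≤a = begin
  2 * ((a + b) * (a + b))              ≤⟨ ≤-by (2 * (b * c)) (expand b c) ⟩
  2 * (a * a) + 3 * (2 * (a * b))      ≤⟨ +-monoˡ-≤ _ h ⟩
  3 * N + 3 * (2 * (a * b))            ≡⟨ *-distribˡ-+ 3 N _ ⟨
  3 * (N + 2 * (a * b))                ≤⟨ *-monoʳ-≤ 3 N≤ ⟩
  3 * N′                               ∎
  where
  open ≤-Reasoning
  expand : ∀ b c → 2 * ((b + c + b) * (b + c + b)) + 2 * (b * c) ≡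
                   2 * ((b + c) * (b + c)) + 3 * (2 * ((b + c) * b))
  expand = solve-∀

matula-edges : ∀ {k x D N} → D + N ≡ (k + x) * (k + x) → 2 * (x * x) ≤ 3 * N →
               6 * D + 4 * (x * x) ≤ 6 * ((k + x) * (k + x))
matula-edges {k} {x} {D} {N} D+N h = begin
  6 * D + 4 * (x * x)         ≡⟨ cong (6 * D +_) (*-assoc 2 2 (x * x)) ⟩
  6 * D + 2 * (2 * (x * x))   ≤⟨ +-monoʳ-≤ (6 * D) (*-monoʳ-≤ 2 h) ⟩
  6 * D + 2 * (3 * N)         ≡⟨ collect D N ⟩
  6 * (D + N)                 ≡⟨ cong (6 *_) D+N ⟩
  6 * ((k + x) * (k + x))     ∎
  where
  open ≤-Reasoning
  collect : ∀ D N → 6 * D + 2 * (3 * N) ≡ 6 * (D + N)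
  collect = solve-∀

-- In the polynomial inequalities below the variables are expressed through the slacks of the
-- hypotheses; the difference of the two sides then has only nonnegative coefficients.
base-slack : ∀ {k x s t} → x + s ≡ 2 * k → 3 * k + t ≡ 2 * x → k ≡ t + 2 * s × x ≡ 2 * t + 3 * s
base-slack {k} {x} {s} {t} x+s 3k+t = k≡ , x≡
  where
  open ≡-Reasoning
  four : ∀ k → 3 * k + k ≡ 2 * (2 * k)
  four = solve-∀
  double : ∀ t s → 2 * (t + 2 * s) ≡ 2 * t + 3 * s + s
  double = solve-∀
  k≡ : k ≡ t + 2 * s
  k≡ = +-cancelˡ-≡ (3 * k) _ _ (begin
    3 * k + k                ≡⟨ four k ⟩
    2 * (2 * k)              ≡⟨ cong (2 *_) x+s ⟨
    2 * (x + s)              ≡⟨ *-distribˡ-+ 2 x s ⟩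
    2 * x + 2 * s            ≡⟨ cong (_+ 2 * s) 3k+t ⟨
    3 * k + t + 2 * s        ≡⟨ +-assoc (3 * k) t _ ⟩
    3 * k + (t + 2 * s)      ∎)
  x≡ : x ≡ 2 * t + 3 * s
  x≡ = +-cancelʳ-≡ s _ _ (trans x+s (trans (cong (2 *_) k≡) (double t s)))

-- The claim is (2x − 3k)(2k − x) ≥ 0.
base-bound : ∀ {k x D} → 6 * D + 4 * (x * x) ≤ 6 * ((k + x) * (k + x)) →
             3 * k ≤ 2 * x → x ≤ 2 * k → 6 * D ≤ 19 * (k * x)
base-bound {k} {x} {D} h 3k≤2x x≤2k
  with t , 3k+t ← m≤n⇒∃[o]m+o≡n 3k≤2x | s , x+s ← m≤n⇒∃[o]m+o≡n x≤2k
  with refl , refl ← base-slack {k} {x} {s} {t} x+s 3k+t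
  = +-cancelʳ-≤ (4 * (x * x)) _ _ (≤-trans h (≤-by (t * s) (expand t s)))
  where
  expand : ∀ t s → let k = t + 2 * s; x = 2 * t + 3 * s in
           6 * ((k + x) * (k + x)) + t * s ≡ 19 * (k * x) + 4 * (x * x)
  expand = solve-∀

-- Since b ≤ k, the trivial count 6b² + 12bk is at most 18bk.
side-bound-≤ : ∀ {k b E N} → E + N ≡ b * b + 2 * (b * k) → b ≤ k → 6 * E ≤ 19 * (k * b)
side-bound-≤ {k} {b} {E} {N} E+N b≤k with c , refl ← m≤n⇒∃[o]m+o≡n b≤k = begin
  6 * E                             ≤⟨ *-monoʳ-≤ 6 (≤-by N E+N) ⟩
  6 * (b * b + 2 * (b * (b + c)))   ≤⟨ ≤-by _ (expand b c) ⟩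
  19 * ((b + c) * b)                ∎
  where
  open ≤-Reasoning
  expand : ∀ b c → 6 * (b * b + 2 * (b * (b + c))) + (b * b + 7 * (b * c)) ≡ 19 * ((b + c) * b)
  expand = solve-∀

side-slack : ∀ {k β s} → 2 * (k + β) + s ≡ 3 * k → k ≡ 2 * β + s
side-slack {k} {β} {s} eq = +-cancelˡ-≡ (2 * k) _ _ (trans (three k) (trans (sym eq) (regroup k β s)))
  where
  three : ∀ k → 2 * k + k ≡ 3 * k
  three = solve-∀
  regroup : ∀ k β s → 2 * (k + β) + s ≡ 2 * k + (2 * β + s)
  regroup = solve-∀

-- The claim follows from (3k − 2b)(3b − 2k) ≥ 0, where b = k + β.
side-bound-> : ∀ {k β E N} → let b = k + β in
               E + N ≡ b * b + 2 * (b * k) → k * β ≤ N → 2 * b ≤ 3 * k → 6 * E ≤ 19 * (k * b)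
side-bound-> {k} {β} {E} {N} E+N kβ≤N 2b≤3k
  with s , 2b+s ← m≤n⇒∃[o]m+o≡n 2b≤3k
  with refl ← side-slack {k} {β} {s} 2b+s = +-cancelʳ-≤ (6 * N) _ _ (begin
    6 * E + 6 * N                  ≡⟨ *-distribˡ-+ 6 E N ⟨
    6 * (E + N)                    ≡⟨ cong (6 *_) E+N ⟩
    6 * (b * b + 2 * (b * k))      ≤⟨ ≤-by (s * (5 * β + s)) (expand β s) ⟩
    19 * (k * b) + 6 * (k * β)     ≤⟨ +-monoʳ-≤ (19 * (k * b)) (*-monoʳ-≤ 6 kβ≤N) ⟩
    19 * (k * b) + 6 * N           ∎)
  where
  open ≤-Reasoning
  b = k + β
  expand : ∀ β s → let k = 2 * β + s; b = k + β in
           6 * (b * b + 2 * (b * k)) + s * (5 * β + s) ≡ 19 * (k * b) + 6 * (k * β)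
  expand = solve-∀

-- Sums the two estimates so that only a polynomial inequality in k, a and b is left. N′ is the
-- guaranteed number of non-edges: 0 when b ≤ k, and kβ when b = k + β.
add-bounds : ∀ k a b D E N N′ →
             6 * D + 4 * (a * a) ≤ 6 * ((k + a) * (k + a)) → E + N ≡ b * b + 2 * (b * k) → N′ ≤ N →
             6 * ((k + a) * (k + a)) + 6 * (b * b + 2 * (b * k)) ≤ 19 * (k * (a + b)) + (4 * (a * a) + 6 * N′) →
             6 * (D + E) ≤ 19 * (k * (a + b))
add-bounds k a b D E N N′ D≤ E+N N′≤N h = +-cancelʳ-≤ (4 * (a * a) + 6 * N) _ _ (begin
  6 * (D + E) + (4 * (a * a) + 6 * N)                     ≡⟨ regroup D E (4 * (a * a)) N ⟩
  6 * D + 4 * (a * a) + 6 * (E + N)                       ≤⟨ +-mono-≤ D≤ (≤-reflexive (cong (6 *_) E+N)) ⟩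
  6 * ((k + a) * (k + a)) + 6 * (b * b + 2 * (b * k))     ≤⟨ h ⟩
  19 * (k * (a + b)) + (4 * (a * a) + 6 * N′)
    ≤⟨ +-monoʳ-≤ (19 * (k * (a + b))) (+-monoʳ-≤ (4 * (a * a)) (*-monoʳ-≤ 6 N′≤N)) ⟩
  19 * (k * (a + b)) + (4 * (a * a) + 6 * N)              ∎)
  where
  open ≤-Reasoning
  regroup : ∀ D E x N → 6 * (D + E) + (x + 6 * N) ≡ 6 * D + x + 6 * (E + N)
  regroup = solve-∀

short-slack-≤ : ∀ {a b s r t} → 2 * (b + s) + r ≡ a + b → 2 * a + t ≡ 3 * (b + s) →
                b ≡ s + 2 * r + t × a ≡ 3 * s + 3 * r + t
short-slack-≤ {a} {b} {s} {r} {t} 2k+r 2a+t = b≡ , trans a≡ (trans (cong (λ b → b + 2 * s + r) b≡) (collect s r t))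
  where
  regroup : ∀ b s r → 2 * (b + s) + r ≡ b + 2 * s + r + b
  regroup = solve-∀
  a≡ : a ≡ b + 2 * s + r
  a≡ = +-cancelʳ-≡ b _ _ (trans (sym 2k+r) (regroup b s r))
  three : ∀ b s → 2 * b + 3 * s + b ≡ 3 * (b + s)
  three = solve-∀
  regroup′ : ∀ b s r t → 2 * (b + 2 * s + r) + t ≡ 2 * b + 3 * s + (s + 2 * r + t)
  regroup′ = solve-∀
  b≡ : b ≡ s + 2 * r + t
  b≡ = +-cancelˡ-≡ (2 * b + 3 * s) _ _
         (trans (three b s) (trans (sym 2a+t) (trans (cong (λ a → 2 * a + t) a≡) (regroup′ b s r t))))
  collect : ∀ s r t → s + 2 * r + t + 2 * s + r ≡ 3 * s + 3 * r + t
  collect = solve-∀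

-- The claim reduces to (3k - 2a)(2k - a) ≤ (7k - 6b)b, tight at a = b = k. From 2k ≤ a + b follow
-- 2k - a ≤ b and 3k - 2a ≤ 2b - k, and the latter is at most 7k - 6b because b ≤ k.
short-bound-≤ : ∀ {k a b D E N} →
                6 * D + 4 * (a * a) ≤ 6 * ((k + a) * (k + a)) → E + N ≡ b * b + 2 * (b * k) →
                b ≤ k → 2 * k ≤ a + b → 2 * a ≤ 3 * k → 6 * (D + E) ≤ 19 * (k * (a + b))
short-bound-≤ {a = a} {b} {D} {E} {N} D≤ E+N b≤k 2k≤a+b 2a≤3k
  with s , refl ← m≤n⇒∃[o]m+o≡n b≤k
  with r , 2k+r ← m≤n⇒∃[o]m+o≡n 2k≤a+b | t , 2a+t ← m≤n⇒∃[o]m+o≡n 2a≤3k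
  with refl , refl ← short-slack-≤ {a} {b} {s} {r} {t} 2k+r 2a+t
  = add-bounds (b + s) a b D E N 0 D≤ E+N z≤n
      (≤-by (8 * (s * s) + 18 * (s * r) + 4 * (r * r) + 8 * (s * t) + 3 * (r * t)) (expand s r t))
  where
  expand : ∀ s r t → let b = s + 2 * r + t; k = b + s; a = 3 * s + 3 * r + t in
    6 * ((k + a) * (k + a)) + 6 * (b * b + 2 * (b * k)) +
    (8 * (s * s) + 18 * (s * r) + 4 * (r * r) + 8 * (s * t) + 3 * (r * t)) ≡
    19 * (k * (a + b)) + (4 * (a * a) + 6 * 0)
  expand = solve-∀

short-slack-> : ∀ {k β c t} → 2 * (k + β + c) + t ≡ 3 * k → k ≡ 2 * β + 2 * c + t
short-slack-> {k} {β} {c} {t} eq = +-cancelˡ-≡ (2 * k) _ _ (trans (three k) (trans (sym eq) (regroup k β c t)))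
  where
  three : ∀ k → 2 * k + k ≡ 3 * k
  three = solve-∀
  regroup : ∀ k β c t → 2 * (k + β + c) + t ≡ 2 * k + (2 * β + 2 * c + t)
  regroup = solve-∀

-- The claim reduces to (3k - 2a)(2k - a) ≤ (3k - 2b)(3b - 2k), tight at a = b = k and at a = b =
-- 3k/2. The first factors compare by b ≤ a, the second by 2k - a ≤ 2k - b ≤ 3b - 2k, as b ≥ k.
short-bound-> : ∀ {k a β D E N} → let b = k + β in
                6 * D + 4 * (a * a) ≤ 6 * ((k + a) * (k + a)) → E + N ≡ b * b + 2 * (b * k) →
                k * β ≤ N → b ≤ a → 2 * a ≤ 3 * k → 6 * (D + E) ≤ 19 * (k * (a + b))
short-bound-> {k} {a} {β} {D} {E} {N} D≤ E+N kβ≤N b≤a 2a≤3k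
  with c , refl ← m≤n⇒∃[o]m+o≡n b≤a
  with t , 2a+t ← m≤n⇒∃[o]m+o≡n 2a≤3k
  with refl ← short-slack-> {k} {β} {c} {t} 2a+t
  = add-bounds k a (k + β) D E N (k * β) D≤ E+N kβ≤N
      (≤-by (10 * (β * c) + 4 * (c * c) + 3 * (c * t) + 4 * (β * t)) (expand β c t))
  where
  expand : ∀ β c t → let k = 2 * β + 2 * c + t; b = k + β; a = b + c in
    6 * ((k + a) * (k + a)) + 6 * (b * b + 2 * (b * k)) +
    (10 * (β * c) + 4 * (c * c) + 3 * (c * t) + 4 * (β * t)) ≡
    19 * (k * (a + b)) + (4 * (a * a) + 6 * (k * β))
  expand = solve-∀

-- With d = M − 2a₂, p = 2a₁ − d and q = 2(b₁ + b₂) − M one has p + q ≥ 2β, while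
-- 2a₁(2b₁ + 2b₂ − 2a₂) = (d + p)(d + q) ≥ d(p + q).
crossing-bound-unbalanced : ∀ a₁ a₂ b₁ b₂ {β M σ} →
  β ≤ a₁ + b₁ → a₁ + a₂ + (b₁ + b₂) ≡ β + σ → M ≤ σ →
  M ≤ 2 * (a₁ + a₂) → M ≤ 2 * (b₁ + b₂) → 2 * a₂ ≤ M →
  β * M ≤ 2 * (a₁ * b₁ + a₁ * b₂ + a₂ * b₁)
crossing-bound-unbalanced a₁ a₂ b₁ b₂ {β} β≤ total M≤σ M≤2a M≤2b 2a₂≤M
  with d , refl ← m≤n⇒∃[o]m+o≡n 2a₂≤M
  with r , refl ← m≤n⇒∃[o]m+o≡n M≤σ
  with p , M+p ← m≤n⇒∃[o]m+o≡n M≤2a | q , M+q ← m≤n⇒∃[o]m+o≡n M≤2b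
  = *-cancelˡ-≤ 2 (begin
    2 * (β * (2 * a₂ + d))                              ≡⟨ split β a₂ d ⟩
    d * (2 * β) + 4 * (a₂ * β)
      ≤⟨ +-mono-≤ (*-monoʳ-≤ d 2β≤p+q) (*-monoʳ-≤ 4 (*-monoʳ-≤ a₂ β≤)) ⟩
    d * (p + q) + 4 * (a₂ * (a₁ + b₁))                  ≤⟨ ≤-by (d * d + p * q) (factor d p q (4 * (a₂ * (a₁ + b₁)))) ⟩
    (d + p) * (d + q) + 4 * (a₂ * (a₁ + b₁))            ≡⟨ cong (λ x → x * (d + q) + 4 * (a₂ * (a₁ + b₁))) d+p ⟩
    2 * a₁ * (d + q) + 4 * (a₂ * (a₁ + b₁))             ≡⟨ absorb a₁ a₂ b₁ (d + q) ⟩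
    2 * a₁ * (2 * a₂ + (d + q)) + 4 * (a₂ * b₁)
      ≡⟨ cong (λ x → 2 * a₁ * x + 4 * (a₂ * b₁)) (trans (sym (+-assoc (2 * a₂) d q)) M+q) ⟩
    2 * a₁ * (2 * (b₁ + b₂)) + 4 * (a₂ * b₁)            ≡⟨ collect a₁ a₂ b₁ b₂ ⟩
    2 * (2 * (a₁ * b₁ + a₁ * b₂ + a₂ * b₁))             ∎)
  where
  M = 2 * a₂ + d
  d+p : d + p ≡ 2 * a₁
  d+p = +-cancelˡ-≡ (2 * a₂) _ _ (trans (trans (sym (+-assoc (2 * a₂) d p)) M+p) (regroup a₁ a₂))
    where regroup : ∀ a₁ a₂ → 2 * (a₁ + a₂) ≡ 2 * a₂ + 2 * a₁
          regroup = solve-∀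
  2β≤p+q : 2 * β ≤ p + q
  2β≤p+q = ≤-by (2 * r) (+-cancelˡ-≡ (2 * M) _ _ (begin
    2 * M + (2 * β + 2 * r)           ≡⟨ regroup M β r ⟩
    2 * (β + (M + r))                 ≡⟨ cong (2 *_) total ⟨
    2 * (a₁ + a₂ + (b₁ + b₂))         ≡⟨ *-distribˡ-+ 2 (a₁ + a₂) _ ⟩
    2 * (a₁ + a₂) + 2 * (b₁ + b₂)     ≡⟨ cong₂ _+_ M+p M+q ⟨
    M + p + (M + q)                   ≡⟨ regroup′ M p q ⟩
    2 * M + (p + q)                   ∎))
    where
    open ≡-Reasoning
    regroup : ∀ M β r → 2 * M + (2 * β + 2 * r) ≡ 2 * (β + (M + r))
    regroup = solve-∀
    regroup′ : ∀ M p q → M + p + (M + q) ≡ 2 * M + (p + q)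
    regroup′ = solve-∀
  open ≤-Reasoning
  split : ∀ β a₂ d → 2 * (β * (2 * a₂ + d)) ≡ d * (2 * β) + 4 * (a₂ * β)
  split = solve-∀
  factor : ∀ d p q x → d * (p + q) + x + (d * d + p * q) ≡ (d + p) * (d + q) + x
  factor = solve-∀
  absorb : ∀ a₁ a₂ b₁ x → 2 * a₁ * x + 4 * (a₂ * (a₁ + b₁)) ≡ 2 * a₁ * (2 * a₂ + x) + 4 * (a₂ * b₁)
  absorb = solve-∀
  collect : ∀ a₁ a₂ b₁ b₂ → 2 * a₁ * (2 * (b₁ + b₂)) + 4 * (a₂ * b₁) ≡ 2 * (2 * (a₁ * b₁ + a₁ * b₂ + a₂ * b₁))
  collect = solve-∀

-- Indices 1 and 2 mark the parts of the two sides in B and in S₀; the product a₂b₂ is absent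
-- because those pairs lie inside S₀. When 2a₂ and 2b₂ both reach M, the mixed products suffice;
-- otherwise one side has few vertices in S₀ and the unbalanced estimate applies.
crossing-bound : ∀ a₁ a₂ b₁ b₂ {β M σ} →
  β ≤ a₁ + b₁ → a₁ + a₂ + (b₁ + b₂) ≡ β + σ → M ≤ σ → M ≤ 2 * (a₁ + a₂) → M ≤ 2 * (b₁ + b₂) →
  β * M ≤ 2 * (a₁ * b₁ + a₁ * b₂ + a₂ * b₁)
crossing-bound a₁ a₂ b₁ b₂ {β} {M} {σ} β≤ total M≤σ M≤2a M≤2b
  with ≤-total M (2 * a₂) | ≤-total M (2 * b₂)
... | inj₂ 2a₂≤M | _ = crossing-bound-unbalanced a₁ a₂ b₁ b₂ β≤ total M≤σ M≤2a M≤2b 2a₂≤M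
... | inj₁ _ | inj₂ 2b₂≤M = subst (β * M ≤_) (flip a₁ a₂ b₁ b₂)
  (crossing-bound-unbalanced b₁ b₂ a₁ a₂ (subst (β ≤_) (+-comm a₁ b₁) β≤)
    (trans (+-comm (b₁ + b₂) _) total) M≤σ M≤2b M≤2a 2b₂≤M)
  where
  flip : ∀ a₁ a₂ b₁ b₂ → 2 * (b₁ * a₁ + b₁ * a₂ + b₂ * a₁) ≡ 2 * (a₁ * b₁ + a₁ * b₂ + a₂ * b₁)
  flip = solve-∀
... | inj₁ M≤2a₂ | inj₁ M≤2b₂ = begin
  β * M                                       ≤⟨ *-monoˡ-≤ M β≤ ⟩
  (a₁ + b₁) * M                               ≡⟨ *-distribʳ-+ M a₁ b₁ ⟩
  a₁ * M + b₁ * M                             ≤⟨ +-mono-≤ (*-monoʳ-≤ a₁ M≤2b₂) (*-monoʳ-≤ b₁ M≤2a₂) ⟩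
  a₁ * (2 * b₂) + b₁ * (2 * a₂)               ≤⟨ ≤-by (2 * (a₁ * b₁)) (regroup a₁ a₂ b₁ b₂) ⟩
  2 * (a₁ * b₁ + a₁ * b₂ + a₂ * b₁)           ∎
  where
  open ≤-Reasoning
  regroup : ∀ a₁ a₂ b₁ b₂ → a₁ * (2 * b₂) + b₁ * (2 * a₂) + 2 * (a₁ * b₁) ≡ 2 * (a₁ * b₁ + a₁ * b₂ + a₂ * b₁)
  regroup = solve-∀

-- The premise on N is phrased through β so that it is vacuous for b < k and free of subtraction
-- otherwise.
side-bound : ∀ {k b E N} → E + N ≡ b * b + 2 * (b * k) → (∀ β → b ≡ k + β → k * β ≤ N) →
             2 * b ≤ 3 * k → 6 * E ≤ 19 * (k * b)
side-bound {k} {b} {E} {N} E+N N≥ 2b≤3k with ≤-total b k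
... | inj₁ b≤k = side-bound-≤ {k} {b} {E} {N} E+N b≤k
... | inj₂ k≤b with β , refl ← m≤n⇒∃[o]m+o≡n k≤b = side-bound-> {k} {β} {E} {N} E+N (N≥ β refl) 2b≤3k

short-bound : ∀ {k a b D E N} →
              6 * D + 4 * (a * a) ≤ 6 * ((k + a) * (k + a)) → E + N ≡ b * b + 2 * (b * k) →
              (∀ β → b ≡ k + β → k * β ≤ N) → b ≤ a → 2 * k ≤ a + b → 2 * a ≤ 3 * k →
              6 * (D + E) ≤ 19 * (k * (a + b))
short-bound {k} {a} {b} {D} {E} {N} D≤ E+N N≥ b≤a 2k≤a+b 2a≤3k with ≤-total b k
... | inj₁ b≤k = short-bound-≤ {k} {a} {b} {D} {E} {N} D≤ E+N b≤k 2k≤a+b 2a≤3k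
... | inj₂ k≤b with β , refl ← m≤n⇒∃[o]m+o≡n k≤b =
  short-bound-> {k} {a} {β} {D} {E} {N} D≤ E+N (N≥ β refl) b≤a 2a≤3k

-- Adjacent and non-adjacent pairs in a graph.

module OfGraph {n} (G : Graph n) where

  Apart : Subset n → Subset n → Set
  Apart A B = ∀ {i j} → i ∈ A → j ∈ B → adj G i j ≡ false

  apart-sym : ∀ {A B} → Apart A B → Apart B A
  apart-sym ap m m′ = trans (adj-sym G _ _) (ap m′ m)

  [_~_] [_≁_] : Fin n → Fin n → ℕ
  [ i ~ j ] = if adj G i j then 1 else 0
  [ i ≁ j ] = if adj G i j then 0 else 1

  ~-sym : ∀ i j → [ i ~ j ] ≡ [ j ~ i ]
  ~-sym i j = cong (if_then 1 else 0) (adj-sym G i j)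

  ≁-sym : ∀ i j → [ i ≁ j ] ≡ [ j ≁ i ]
  ≁-sym i j = cong (if_then 0 else 1) (adj-sym G i j)

  ~+≁ : ∀ i j → [ i ~ j ] + [ i ≁ j ] ≡ 1
  ~+≁ i j with adj G i j
  ... | true  = refl
  ... | false = refl

  deg : Subset n → Fin n → ℕ
  deg p v = ∑ p [ v ~_]

  -- Ordered pairs; a vertex counts as non-adjacent to itself.
  edges non-edges : Subset n → Subset n → ℕ
  edges     = pairs [_~_]
  non-edges = pairs [_≁_]

  edges+non-edges : ∀ p q → edges p q + non-edges p q ≡ ∣ p ∣ * ∣ q ∣
  edges+non-edges p q = begin
    edges p q + non-edges p q                               ≡⟨ ∑-+ p _ _ ⟨
    ∑ p (λ i → ∑ q [ i ~_] + ∑ q [ i ≁_])                   ≡⟨ ∑-cong {p = p} (λ _ → sym (∑-+ q _ _)) ⟩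
    ∑ p (λ i → ∑ q (λ j → [ i ~ j ] + [ i ≁ j ]))           ≡⟨ ∑-cong {p = p} (λ _ → ∑-cong {p = q} (λ _ → ~+≁ _ _)) ⟩
    ∑ p (λ _ → ∑ q (λ _ → 1))                               ≡⟨ ∑-const p _ ⟩
    ∣ p ∣ * ∑ q (λ _ → 1)                                   ≡⟨ cong (∣ p ∣ *_) (trans (∑-const q 1) (*-identityʳ ∣ q ∣)) ⟩
    ∣ p ∣ * ∣ q ∣                                           ∎
    where open ≡-Reasoning

  deg≤ : ∀ p v → deg p v ≤ ∣ p ∣
  deg≤ p v = begin
    deg p v        ≤⟨ ∑-mono {p = p} {g = λ _ → 1} (λ {j} _ → ≤-by _ (~+≁ v j)) ⟩
    ∑ p (λ _ → 1)  ≡⟨ trans (∑-const p 1) (*-identityʳ ∣ p ∣) ⟩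
    ∣ p ∣          ∎
    where open ≤-Reasoning

  deg-apart : ∀ {A B} {v} → Apart A B → v ∈ A → deg B v ≡ 0
  deg-apart {A} {B} ap m = trans (∑-cong {p = B} {g = λ _ → 0} (λ m′ → cong (if_then 1 else 0) (ap m m′)))
                                 (trans (∑-const B 0) (*-zeroʳ ∣ B ∣))

  non-deg-apart : ∀ {A B} {v} → Apart A B → v ∈ A → ∑ B [ v ≁_] ≡ ∣ B ∣
  non-deg-apart {A} {B} ap m = trans (∑-cong {p = B} {g = λ _ → 1} (λ m′ → cong (if_then 0 else 1) (ap m m′)))
                                     (trans (∑-const B 1) (*-identityʳ ∣ B ∣))

  edges-apart : ∀ {A B} → Apart A B → edges A B ≡ 0
  edges-apart {A} ap = trans (∑-cong {p = A} {g = λ _ → 0} (deg-apart ap)) (trans (∑-const A 0) (*-zeroʳ ∣ A ∣))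

  non-edges-apart : ∀ {A B} → Apart A B → non-edges A B ≡ ∣ A ∣ * ∣ B ∣
  non-edges-apart {A} {B} ap = trans (∑-cong {p = A} {g = λ _ → ∣ B ∣} (non-deg-apart ap)) (∑-const A ∣ B ∣)

  ∣∣≤non-edges : ∀ p → ∣ p ∣ ≤ non-edges p p
  ∣∣≤non-edges p = begin
    ∣ p ∣          ≡⟨ trans (∑-const p 1) (*-identityʳ ∣ p ∣) ⟨
    ∑ p (λ _ → 1)  ≤⟨ ∑-mono {p = p} (λ {i} m → subst (_≤ ∑ p [ i ≁_]) (loop i) (∑-member m [ i ≁_])) ⟩
    non-edges p p  ∎
    where
    open ≤-Reasoning
    loop : ∀ i → [ i ≁ i ] ≡ 1
    loop i = cong (if_then 0 else 1) (adj-irrefl G i)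

  -- Separations.

  record Separation (k : ℕ) (U : Subset n) : Set where
    field
      {A B S W} : Subset n
      splitᵁ : Split U S W
      splitᵂ : Split W A B
      ∣S∣≡k  : ∣ S ∣ ≡ k
      0<∣A∣  : 1 ≤ ∣ A ∣
      0<∣B∣  : 1 ≤ ∣ B ∣
      apart  : Apart A B

    ∣U∣ : ∣ U ∣ ≡ k + (∣ A ∣ + ∣ B ∣)
    ∣U∣ = trans (∣∣-split splitᵁ) (cong₂ _+_ ∣S∣≡k (∣∣-split splitᵂ))

    -- This is S ∪ A, what remains after side B is deleted; for the flipped separation it is S ∪ B.
    T : Subset n
    T = proj₁ (split-assoc splitᵁ splitᵂ)

    U=T+B : Split U T B
    U=T+B = proj₁ (proj₂ (split-assoc splitᵁ splitᵂ))

    T=S+A : Split T S A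
    T=S+A = proj₂ (proj₂ (split-assoc splitᵁ splitᵂ))

    ∣T∣ : ∣ T ∣ ≡ k + ∣ A ∣
    ∣T∣ = trans (∣∣-split T=S+A) (cong (_+ ∣ A ∣) ∣S∣≡k)

    edges-T+B : edges U U ≡ edges T T + (edges B B + 2 * edges B S)
    edges-T+B = begin
      edges U U                                     ≡⟨ pairs-square _ ~-sym U=T+B ⟩
      edges T T + 2 * edges T B + edges B B         ≡⟨ cong (λ x → edges T T + 2 * x + edges B B) TB≡BS ⟩
      edges T T + 2 * edges B S + edges B B         ≡⟨ regroup (edges T T) (edges B S) (edges B B) ⟩
      edges T T + (edges B B + 2 * edges B S)       ∎
      where
      open ≡-Reasoning
      TB≡BS : edges T B ≡ edges B S
      TB≡BS = begin
        edges T B              ≡⟨ pairs-splitˡ _ T=S+A B ⟩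
        edges S B + edges A B  ≡⟨ cong₂ _+_ (pairs-comm _ ~-sym S B) (edges-apart apart) ⟩
        edges B S + 0          ≡⟨ +-identityʳ _ ⟩
        edges B S              ∎
      regroup : ∀ a b c → a + 2 * b + c ≡ a + (c + 2 * b)
      regroup = solve-∀

    non-edges-T+B : non-edges T T + 2 * (∣ A ∣ * ∣ B ∣) ≤ non-edges U U
    non-edges-T+B = begin
      non-edges T T + 2 * (∣ A ∣ * ∣ B ∣)                     ≡⟨ cong (λ x → non-edges T T + 2 * x) (non-edges-apart apart) ⟨
      non-edges T T + 2 * non-edges A B                       ≤⟨ +-monoʳ-≤ (non-edges T T) (*-monoʳ-≤ 2 (pairs-monoˡ _ (split-comm T=S+A) B)) ⟩
      non-edges T T + 2 * non-edges T B                       ≤⟨ m≤m+n _ (non-edges B B) ⟩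
      non-edges T T + 2 * non-edges T B + non-edges B B       ≡⟨ pairs-square _ ≁-sym U=T+B ⟨
      non-edges U U                                           ∎
      where open ≤-Reasoning

  flip : ∀ {k U} → Separation k U → Separation k U
  flip sep = record { splitᵁ = splitᵁ ; splitᵂ = split-comm splitᵂ ; ∣S∣≡k = ∣S∣≡k
                    ; 0<∣A∣ = 0<∣B∣ ; 0<∣B∣ = 0<∣A∣ ; apart = apart-sym apart }
    where open Separation sep

  -- Non-edges forced by separations.

  module _ {k} (separate : ∀ U → k + 2 ≤ ∣ U ∣ → Separation k U) where

    separate-balanced : ∀ U → k + 2 ≤ ∣ U ∣ →
                        Σ (Separation k U) λ sep → ∣ Separation.B sep ∣ ≤ ∣ Separation.A sep ∣
    separate-balanced U l with sep ← separate U l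
      with ≤-total ∣ Separation.B sep ∣ ∣ Separation.A sep ∣
    ... | inj₁ B≤A = sep , B≤A
    ... | inj₂ A≤B = flip sep , A≤B

    -- Matula's bound: delete the smaller side and count only the pairs between the sides.
    matula-bounded : ∀ m U x → ∣ U ∣ ≡ k + x → x ≤ m → 2 * (x * x) ≤ 3 * non-edges U U
    matula-bounded m U 0 ∣U∣ _ = z≤n
    -- Separations are available only from x = 2 on. For x = 1 the diagonal pairs, counted as
    -- non-edges, are enough.
    matula-bounded m U 1 ∣U∣ _ = *-mono-≤ {2} {3} (s≤s (s≤s z≤n)) (begin
      1              ≤⟨ m≤n+m 1 k ⟩
      k + 1          ≡⟨ ∣U∣ ⟨
      ∣ U ∣          ≤⟨ ∣∣≤non-edges U ⟩
      non-edges U U  ∎)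
      where open ≤-Reasoning
    matula-bounded (suc m) U x@(suc (suc _)) ∣U∣≡ (s≤s x≤m)
      with sep , B≤A ← separate-balanced U (≤-trans (+-monoʳ-≤ k (s≤s (s≤s z≤n))) (≤-reflexive (sym ∣U∣≡)))
      with U≡ ← +-cancelˡ-≡ k _ _ (trans (sym ∣U∣≡) (Separation.∣U∣ sep))
      = subst (λ y → 2 * (y * y) ≤ 3 * non-edges U U) (sym U≡)
          (matula-step ∣ A ∣ ∣ B ∣ {non-edges T T} B≤A (matula-bounded m T ∣ A ∣ ∣T∣ A≤m) non-edges-T+B)
      where
      open Separation sep
      A≤m : ∣ A ∣ ≤ m
      A≤m = s≤s⁻¹ (begin-strict
        ∣ A ∣          <⟨ m<m+n ∣ A ∣ 0<∣B∣ ⟩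
        ∣ A ∣ + ∣ B ∣  ≡⟨ U≡ ⟨
        x              ≤⟨ s≤s x≤m ⟩
        suc m          ∎)
        where open ≤-Reasoning

    matula : ∀ U x → ∣ U ∣ ≡ k + x → 2 * (x * x) ≤ 3 * non-edges U U
    matula U x ∣U∣ = matula-bounded x U x ∣U∣ ≤-refl

    -- A vertex v ∈ X₁ has at most k + ∣X∣ + ∣S₁∣ neighbours in Z.
    heavy-side : ∀ {Z Q S₁ S′ W B X Y X₁ X₂ Y₁ β} {B′ S₀ W₁ : Subset n} →
      Split Z Q S₁ → Split Q S′ W → Split W X Y → Split B B′ W₁ → Split W₁ X₁ Y₁ → Split X X₁ X₂ →
      Apart X Y → X₂ ⊆ S₀ → X₁ ⊆ B → Y₁ ⊆ Y → ∣ S′ ∣ ≡ k → 1 ≤ ∣ X ∣ → β ≤ ∣ W₁ ∣ →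
      (∀ {v} → v ∈ S₀ → ∑ B [ v ≁_] < β) → (∀ {v} → v ∈ B → 3 * k ≤ 2 * deg Z v) →
      k ≤ 2 * ∣ X ∣ + 2 * ∣ S₁ ∣
    heavy-side {Z} {Q} {S₁} {S′} {W} {B} {X} {Y} {X₁} {X₂} {Y₁} {β} {W₁ = W₁}
      Z=Q+S₁ Q=S′+W W=X+Y B=B′+W₁ W₁=X₁+Y₁ X=X₁+X₂ X≁Y X₂⊆S₀ X₁⊆B Y₁⊆Y ∣S′∣ 0<∣X∣ β≤∣W₁∣ few-non-nbrs large-deg
      with x , x∈X ← nonempty 0<∣X∣ | ∣ X₁ ∣ in ∣X₁∣
    ... | suc _ = +-cancelˡ-≤ (2 * k) _ _ (begin
        2 * k + k                                 ≡⟨ three k ⟩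
        3 * k                                     ≤⟨ large-deg (X₁⊆B v∈X₁) ⟩
        2 * deg Z v                               ≤⟨ *-monoʳ-≤ 2 deg-v ⟩
        2 * (k + ∣ X ∣ + ∣ S₁ ∣)                  ≡⟨ regroup k ∣ X ∣ ∣ S₁ ∣ ⟩
        2 * k + (2 * ∣ X ∣ + 2 * ∣ S₁ ∣)          ∎)
      where
      v,v∈X₁ : ∃ λ v → v ∈ X₁
      v,v∈X₁ = nonempty (subst (1 ≤_) (sym ∣X₁∣) (s≤s z≤n))
      v = proj₁ v,v∈X₁
      v∈X₁ = proj₂ v,v∈X₁
      three : ∀ k → 2 * k + k ≡ 3 * k
      three = solve-∀
      regroup : ∀ k x y → 2 * (k + x + y) ≡ 2 * k + (2 * x + 2 * y)
      regroup = solve-∀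
      open ≤-Reasoning
      deg-v : deg Z v ≤ k + ∣ X ∣ + ∣ S₁ ∣
      deg-v = begin
        deg Z v                                        ≡⟨ ∑-split Z=Q+S₁ _ ⟩
        deg Q v + deg S₁ v                             ≡⟨ cong (_+ deg S₁ v) (∑-split Q=S′+W _) ⟩
        deg S′ v + deg W v + deg S₁ v                  ≡⟨ cong (λ x → deg S′ v + x + deg S₁ v) (∑-split W=X+Y _) ⟩
        deg S′ v + (deg X v + deg Y v) + deg S₁ v
          ≡⟨ cong (λ x → deg S′ v + (deg X v + x) + deg S₁ v) (deg-apart X≁Y (∈-splitˡ X=X₁+X₂ v∈X₁)) ⟩
        deg S′ v + (deg X v + 0) + deg S₁ v            ≡⟨ cong (λ x → deg S′ v + x + deg S₁ v) (+-identityʳ _) ⟩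
        deg S′ v + deg X v + deg S₁ v                  ≤⟨ +-mono-≤ (+-mono-≤ (deg≤ S′ v) (deg≤ X v)) (deg≤ S₁ v) ⟩
        ∣ S′ ∣ + ∣ X ∣ + ∣ S₁ ∣                        ≡⟨ cong (λ x → x + ∣ X ∣ + ∣ S₁ ∣) ∣S′∣ ⟩
        k + ∣ X ∣ + ∣ S₁ ∣                             ∎
    -- If X missed B, all of W₁ would lie in Y, and x ∈ S₀ would have at least β non-neighbours in
    -- B.
    ... | zero = contradiction (begin-strict
        β                    ≤⟨ β≤∣W₁∣ ⟩
        ∣ W₁ ∣               ≡⟨ ∣∣-split W₁=X₁+Y₁ ⟩
        ∣ X₁ ∣ + ∣ Y₁ ∣      ≡⟨ cong (_+ ∣ Y₁ ∣) ∣X₁∣ ⟩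
        ∣ Y₁ ∣               ≡⟨ non-deg-apart {X} (λ m m′ → X≁Y m (Y₁⊆Y m′)) x∈X ⟨
        ∑ Y₁ [ x ≁_]         ≤⟨ ∑-monoˢ (split-comm W₁=X₁+Y₁) _ ⟩
        ∑ W₁ [ x ≁_]         ≤⟨ ∑-monoˢ (split-comm B=B′+W₁) _ ⟩
        ∑ B [ x ≁_]          <⟨ few-non-nbrs (X₂⊆S₀ x∈X₂) ⟩
        β                    ∎) (<-irrefl refl)
      where
      open ≤-Reasoning
      x∈X₂ : x ∈ X₂
      x∈X₂ with ∈-split⁻ X=X₁+X₂ x∈X
      ... | inj₁ x∈X₁ = contradiction x∈X₁ (empty⇒∉ ∣X₁∣)
      ... | inj₂ m    = m

    -- Since k = M + 2∣S₁∣, `heavy-side` gives M ≤ 2∣X∣ and M ≤ 2∣Y∣ for the two sides. Their mutual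
    -- non-edges are then charged by location: X₁Y₁ to `non-edges B B`, in both orders, and X₁Y₂ and
    -- X₂Y₁ to `non-edges B S₀`.
    separated-side : ∀ {Z Q S₀ S₁ B β M} → Split Z Q S₁ → Split Q B S₀ → ∣ B ∣ ≡ k + β →
      ∣ S₀ ∣ + ∣ S₁ ∣ ≡ k → ∣ S₁ ∣ + M ≡ ∣ S₀ ∣ →
      (∀ {v} → v ∈ S₀ → ∑ B [ v ≁_] < β) → (∀ {v} → v ∈ B → 3 * k ≤ 2 * deg Z v) →
      Separation k Q → β * M ≤ non-edges B B + 2 * non-edges B S₀
    separated-side {Z} {Q} {S₀} {S₁} {B} {β} {M} Z=Q+S₁ Q=B+S₀ ∣B∣ ∣S₀∣+∣S₁∣ ∣S₁∣+M few-non-nbrs large-deg sep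
      with refinement {qt = W₁} {rt = W₂} B=S′₁+W₁ S₀=S′₂+W₂ S′=S′₁+S′₂ W=W₁+W₂
             ← refine Q=B+S₀ (Separation.splitᵁ sep)
      with refinement {X₁} {Y₁} {X₂} {Y₂} W₁=X₁+Y₁ W₂=X₂+Y₂ X=X₁+X₂ Y=Y₁+Y₂
             ← refine W=W₁+W₂ (Separation.splitᵂ sep)
      = begin
        β * M
          ≤⟨ crossing-bound (∣ X₁ ∣) (∣ X₂ ∣) (∣ Y₁ ∣) (∣ Y₂ ∣) β≤X₁+Y₁ total (≤-trans (m≤n+m M ∣ S₁ ∣) (≤-reflexive ∣S₁∣+M))
               (subst (λ x → M ≤ 2 * x) (∣∣-split X=X₁+X₂) (M≤ X
                 (heavy-side Z=Q+S₁ splitᵁ splitᵂ B=S′₁+W₁ W₁=X₁+Y₁ X=X₁+X₂ apart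
                   X₂⊆S₀ X₁⊆B (∈-splitˡ Y=Y₁+Y₂) ∣S∣≡k 0<∣A∣ β≤W₁ few-non-nbrs large-deg)))
               (subst (λ x → M ≤ 2 * x) (∣∣-split Y=Y₁+Y₂) (M≤ Y
                 (heavy-side Z=Q+S₁ splitᵁ (split-comm splitᵂ) B=S′₁+W₁ (split-comm W₁=X₁+Y₁) Y=Y₁+Y₂ (apart-sym apart)
                   Y₂⊆S₀ Y₁⊆B (∈-splitˡ X=X₁+X₂) ∣S∣≡k 0<∣B∣ β≤W₁ few-non-nbrs large-deg))) ⟩
        2 * (∣ X₁ ∣ * ∣ Y₁ ∣ + ∣ X₁ ∣ * ∣ Y₂ ∣ + ∣ X₂ ∣ * ∣ Y₁ ∣)
          ≡⟨ regroup (∣ X₁ ∣ * ∣ Y₁ ∣) (∣ X₁ ∣ * ∣ Y₂ ∣) (∣ X₂ ∣ * ∣ Y₁ ∣) ⟩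
        2 * (∣ X₁ ∣ * ∣ Y₁ ∣) + 2 * (∣ X₁ ∣ * ∣ Y₂ ∣ + ∣ X₂ ∣ * ∣ Y₁ ∣)
          ≤⟨ +-mono-≤ inner (*-monoʳ-≤ 2 outer) ⟩
        non-edges B B + 2 * non-edges B S₀ ∎
      where
      open Separation sep renaming (A to X; B to Y; S to S′)
      open ≤-Reasoning
      regroup : ∀ a b c → 2 * (a + b + c) ≡ 2 * a + 2 * (b + c)
      regroup = solve-∀
      X₁⊆B : X₁ ⊆ B
      X₁⊆B m = ∈-splitʳ B=S′₁+W₁ (∈-splitˡ W₁=X₁+Y₁ m)
      Y₁⊆B : Y₁ ⊆ B
      Y₁⊆B m = ∈-splitʳ B=S′₁+W₁ (∈-splitʳ W₁=X₁+Y₁ m)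
      X₂⊆S₀ : X₂ ⊆ S₀
      X₂⊆S₀ m = ∈-splitʳ S₀=S′₂+W₂ (∈-splitˡ W₂=X₂+Y₂ m)
      Y₂⊆S₀ : Y₂ ⊆ S₀
      Y₂⊆S₀ m = ∈-splitʳ S₀=S′₂+W₂ (∈-splitʳ W₂=X₂+Y₂ m)
      M≤ : ∀ P → k ≤ 2 * ∣ P ∣ + 2 * ∣ S₁ ∣ → M ≤ 2 * ∣ P ∣
      M≤ P h = +-cancelʳ-≤ (2 * ∣ S₁ ∣) _ _ (begin
        M + 2 * ∣ S₁ ∣            ≡⟨ regroup′ M ∣ S₁ ∣ ⟩
        ∣ S₁ ∣ + M + ∣ S₁ ∣       ≡⟨ cong (_+ ∣ S₁ ∣) ∣S₁∣+M ⟩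
        ∣ S₀ ∣ + ∣ S₁ ∣           ≡⟨ ∣S₀∣+∣S₁∣ ⟩
        k                         ≤⟨ h ⟩
        2 * ∣ P ∣ + 2 * ∣ S₁ ∣    ∎)
        where
        regroup′ : ∀ m s → m + 2 * s ≡ s + m + s
        regroup′ = solve-∀
      -- The new separator has k vertices, so it removes at most k of the k + β vertices of B.
      β≤W₁ : β ≤ ∣ W₁ ∣
      β≤W₁ = +-cancelˡ-≤ k _ _ (begin
        k + β               ≡⟨ ∣B∣ ⟨
        ∣ B ∣               ≡⟨ ∣∣-split B=S′₁+W₁ ⟩
        _ + ∣ W₁ ∣          ≤⟨ +-monoˡ-≤ ∣ W₁ ∣ (≤-trans (≤-by _ (sym (∣∣-split S′=S′₁+S′₂))) (≤-reflexive ∣S∣≡k)) ⟩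
        k + ∣ W₁ ∣          ∎)
      β≤X₁+Y₁ : β ≤ ∣ X₁ ∣ + ∣ Y₁ ∣
      β≤X₁+Y₁ = subst (β ≤_) (∣∣-split W₁=X₁+Y₁) β≤W₁
      total : ∣ X₁ ∣ + ∣ X₂ ∣ + (∣ Y₁ ∣ + ∣ Y₂ ∣) ≡ β + ∣ S₀ ∣
      total = +-cancelˡ-≡ k _ _ (begin-equality
        k + (∣ X₁ ∣ + ∣ X₂ ∣ + (∣ Y₁ ∣ + ∣ Y₂ ∣))  ≡⟨ cong₂ (λ x y → k + (x + y)) (∣∣-split X=X₁+X₂) (∣∣-split Y=Y₁+Y₂) ⟨
        k + (∣ X ∣ + ∣ Y ∣)                        ≡⟨ ∣U∣ ⟨
        ∣ Q ∣                                      ≡⟨ ∣∣-split Q=B+S₀ ⟩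
        ∣ B ∣ + ∣ S₀ ∣                             ≡⟨ cong (_+ ∣ S₀ ∣) ∣B∣ ⟩
        k + β + ∣ S₀ ∣                             ≡⟨ +-assoc k β _ ⟩
        k + (β + ∣ S₀ ∣)                           ∎)
      apart-⊆ : ∀ {P R} → P ⊆ X → R ⊆ Y → ∣ P ∣ * ∣ R ∣ ≡ non-edges P R
      apart-⊆ P⊆X R⊆Y = sym (non-edges-apart λ m m′ → apart (P⊆X m) (R⊆Y m′))
      X₁⊆X = ∈-splitˡ X=X₁+X₂
      X₂⊆X = ∈-splitʳ X=X₁+X₂
      Y₁⊆Y = ∈-splitˡ Y=Y₁+Y₂
      Y₂⊆Y = ∈-splitʳ Y=Y₁+Y₂
      inner : 2 * (∣ X₁ ∣ * ∣ Y₁ ∣) ≤ non-edges B B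
      inner = begin
        2 * (∣ X₁ ∣ * ∣ Y₁ ∣)     ≡⟨ cong (2 *_) (apart-⊆ X₁⊆X Y₁⊆Y) ⟩
        2 * non-edges X₁ Y₁       ≤⟨ m≤n+m _ (non-edges X₁ X₁) ⟩
        non-edges X₁ X₁ + 2 * non-edges X₁ Y₁  ≤⟨ m≤m+n _ (non-edges Y₁ Y₁) ⟩
        non-edges X₁ X₁ + 2 * non-edges X₁ Y₁ + non-edges Y₁ Y₁  ≡⟨ pairs-square _ ≁-sym W₁=X₁+Y₁ ⟨
        non-edges W₁ W₁           ≤⟨ pairs-monoˡ _ (split-comm B=S′₁+W₁) W₁ ⟩
        non-edges B W₁            ≤⟨ pairs-monoʳ _ (split-comm B=S′₁+W₁) B ⟩
        non-edges B B             ∎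
      outer : ∣ X₁ ∣ * ∣ Y₂ ∣ + ∣ X₂ ∣ * ∣ Y₁ ∣ ≤ non-edges B S₀
      outer = begin
        ∣ X₁ ∣ * ∣ Y₂ ∣ + ∣ X₂ ∣ * ∣ Y₁ ∣       ≡⟨ cong₂ _+_ (apart-⊆ X₁⊆X Y₂⊆Y) (trans (apart-⊆ X₂⊆X Y₁⊆Y) (pairs-comm _ ≁-sym X₂ Y₁)) ⟩
        non-edges X₁ Y₂ + non-edges Y₁ X₂       ≤⟨ +-mono-≤ (pairs-monoʳ _ (split-comm W₂=X₂+Y₂) X₁) (pairs-monoʳ _ W₂=X₂+Y₂ Y₁) ⟩
        non-edges X₁ W₂ + non-edges Y₁ W₂       ≡⟨ pairs-splitˡ _ W₁=X₁+Y₁ W₂ ⟨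
        non-edges W₁ W₂                         ≤⟨ pairs-monoˡ _ (split-comm B=S′₁+W₁) W₂ ⟩
        non-edges B W₂                          ≤⟨ pairs-monoʳ _ (split-comm S₀=S′₂+W₂) B ⟩
        non-edges B S₀                          ∎

    -- Let S₀ consist of the vertices of S with fewer than β non-neighbours in B.  If S₀ is large,
    -- both sides of a separation of B ∪ S₀ meet B and hence, by the degree condition, are large.
    side-non-edges : ∀ {Z S B β} → Split Z S B → ∣ S ∣ ≡ k → ∣ B ∣ ≡ k + β →
                     (∀ {v} → v ∈ B → 3 * k ≤ 2 * deg Z v) →
                     k * β ≤ non-edges B B + 2 * non-edges B S
    side-non-edges {β = zero} _ _ _ _ = ≤-trans (≤-reflexive (*-zeroʳ k)) z≤n
    side-non-edges {Z} {S} {B} {β@(suc _)} Z=S+B ∣S∣ ∣B∣ large-deg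
      with S₀ , S₁ , S=S₀+S₁ , few , many ← split-by (λ v → ∑ B [ v ≁_] <? β) S
      = by-size (≤-<-connex ∣ S₀ ∣ ∣ S₁ ∣)
      where
      open ≤-Reasoning
      k≡ : ∣ S₀ ∣ + ∣ S₁ ∣ ≡ k
      k≡ = trans (sym (∣∣-split S=S₀+S₁)) ∣S∣
      double : ∀ s β → (s + s) * β ≡ 2 * (s * β)
      double = solve-∀
      S₁β≤ : ∣ S₁ ∣ * β ≤ non-edges B S₁
      S₁β≤ = begin
        ∣ S₁ ∣ * β          ≡⟨ ∑-const S₁ β ⟨
        ∑ S₁ (λ _ → β)      ≤⟨ ∑-mono {p = S₁} (≮⇒≥ ∘ many) ⟩
        non-edges S₁ B      ≡⟨ pairs-comm _ ≁-sym S₁ B ⟩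
        non-edges B S₁      ∎
      regroup : ∀ s m β → (s + m + s) * β ≡ β * m + 2 * (s * β)
      regroup = solve-∀
      regroup′ : ∀ a b c → a + 2 * b + 2 * c ≡ a + 2 * (b + c)
      regroup′ = solve-∀
      by-size : ∣ S₀ ∣ ≤ ∣ S₁ ∣ ⊎ ∣ S₁ ∣ < ∣ S₀ ∣ → k * β ≤ non-edges B B + 2 * non-edges B S
      by-size (inj₁ S₀≤S₁) = begin
        k * β                                         ≡⟨ cong (_* β) k≡ ⟨
        (∣ S₀ ∣ + ∣ S₁ ∣) * β                         ≤⟨ *-monoˡ-≤ β (+-monoˡ-≤ ∣ S₁ ∣ S₀≤S₁) ⟩
        (∣ S₁ ∣ + ∣ S₁ ∣) * β                         ≡⟨ double ∣ S₁ ∣ β ⟩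
        2 * (∣ S₁ ∣ * β)                              ≤⟨ *-monoʳ-≤ 2 S₁β≤ ⟩
        2 * non-edges B S₁                            ≤⟨ *-monoʳ-≤ 2 (pairs-monoʳ _ (split-comm S=S₀+S₁) B) ⟩
        2 * non-edges B S                             ≤⟨ m≤n+m _ (non-edges B B) ⟩
        non-edges B B + 2 * non-edges B S             ∎
      -- With k = M + 2∣S₁∣, the vertices of S₁ pay for 2∣S₁∣β and the separation of B ∪ S₀ pays for
      -- the remaining βM.
      by-size (inj₂ S₁<S₀)
        with Q , Z=Q+S₁ , Q=B+S₀ ← split-assoc (split-comm Z=S+B) S=S₀+S₁
        with M , S₁+M ← m≤n⇒∃[o]m+o≡n (<⇒≤ S₁<S₀) = begin
        k * β                                           ≡⟨ cong (_* β) k≡ ⟨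
        (∣ S₀ ∣ + ∣ S₁ ∣) * β                           ≡⟨ cong (λ s → (s + ∣ S₁ ∣) * β) S₁+M ⟨
        (∣ S₁ ∣ + M + ∣ S₁ ∣) * β                       ≡⟨ regroup ∣ S₁ ∣ M β ⟩
        β * M + 2 * (∣ S₁ ∣ * β)
          ≤⟨ +-mono-≤ (separated-side Z=Q+S₁ Q=B+S₀ ∣B∣ k≡ S₁+M few large-deg (separate Q (begin
               -- β ≥ 1, which is why β = 0 is treated apart, and a vertex of S₀ supply the two
               -- vertices beyond k.
               k + 2              ≤⟨ +-monoʳ-≤ k (+-mono-≤ {1} {β} {1} (s≤s z≤n) (≤-trans (s≤s z≤n) S₁<S₀)) ⟩
               k + (β + ∣ S₀ ∣)   ≡⟨ +-assoc k β _ ⟨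
               k + β + ∣ S₀ ∣     ≡⟨ trans (∣∣-split Q=B+S₀) (cong (_+ ∣ S₀ ∣) ∣B∣) ⟨
               ∣ Q ∣              ∎))) (*-monoʳ-≤ 2 S₁β≤) ⟩
        non-edges B B + 2 * non-edges B S₀ + 2 * non-edges B S₁   ≡⟨ regroup′ (non-edges B B) (non-edges B S₀) (non-edges B S₁) ⟩
        non-edges B B + 2 * (non-edges B S₀ + non-edges B S₁)     ≡⟨ cong (λ x → non-edges B B + 2 * x) (pairs-splitʳ _ S=S₀+S₁ B) ⟨
        non-edges B B + 2 * non-edges B S                         ∎

  -- Induction for the edge bound.

  edges-delete : ∀ {U v} → v ∈ U → edges U U ≤ edges (U ─ ⁅ v ⁆) (U ─ ⁅ v ⁆) + 2 * deg U v
  edges-delete {U} {v} v∈U = begin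
    edges U U                                    ≡⟨ pairs-square _ ~-sym d ⟩
    edges ⁅ v ⁆ ⁅ v ⁆ + 2 * edges ⁅ v ⁆ V + edges V V ≡⟨ regroup (edges ⁅ v ⁆ ⁅ v ⁆) (edges ⁅ v ⁆ V) (edges V V) ⟩
    edges V V + (edges ⁅ v ⁆ ⁅ v ⁆ + edges ⁅ v ⁆ V + edges ⁅ v ⁆ V)
      -- The pair (v, v) is added a second time so that both copies of `deg U v` are complete.
      ≤⟨ +-monoʳ-≤ (edges V V) (+-monoʳ-≤ (edges ⁅ v ⁆ ⁅ v ⁆ + edges ⁅ v ⁆ V) (m≤n+m _ (edges ⁅ v ⁆ ⁅ v ⁆))) ⟩
    edges V V + (edges ⁅ v ⁆ ⁅ v ⁆ + edges ⁅ v ⁆ V + (edges ⁅ v ⁆ ⁅ v ⁆ + edges ⁅ v ⁆ V))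
      ≡⟨ cong (λ x → edges V V + (x + x)) (trans (sym (pairs-splitʳ _ d ⁅ v ⁆)) (∑-one v _)) ⟩
    edges V V + (deg U v + deg U v)              ≡⟨ cong (λ x → edges V V + (deg U v + x)) (+-identityʳ _) ⟨
    edges V V + 2 * deg U v                      ∎
    where
    open ≤-Reasoning
    V = U ─ ⁅ v ⁆
    d : Split U ⁅ v ⁆ V
    d = split-one v∈U
    regroup : ∀ a b c → a + 2 * b + c ≡ c + (a + b + b)
    regroup = solve-∀

  module _ {k} (2≤k : 2 ≤ k) (separate : ∀ U → k + 2 ≤ ∣ U ∣ → Separation k U) where

    matula-edge-bound : ∀ U x → ∣ U ∣ ≡ k + x → 6 * edges U U + 4 * (x * x) ≤ 6 * ((k + x) * (k + x))
    matula-edge-bound U x ∣U∣ = matula-edges {k} {x} {edges U U} {non-edges U U}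
      (trans (edges+non-edges U U) (cong₂ _*_ ∣U∣ ∣U∣)) (matula separate U x ∣U∣)

    EdgeBound : Subset n → Set
    EdgeBound U = ∀ x → ∣ U ∣ ≡ k + x → 3 * k ≤ 2 * x → 6 * edges U U ≤ 19 * (k * x)

    -- Lowering x by one costs 19k on the right, while the deleted vertex accounts for at most 12
    -- deg < 18k on the left.
    edge-bound-delete : ∀ {U v} → v ∈ U → 2 * deg U v < 3 * k → EdgeBound (U ─ ⁅ v ⁆) →
                        ∀ x → ∣ U ∣ ≡ k + suc x → 3 * k ≤ 2 * x → 6 * edges U U ≤ 19 * (k * suc x)
    edge-bound-delete {U} {v} v∈U low ih x ∣U∣ 3k≤2x = begin
      6 * edges U U                           ≤⟨ *-monoʳ-≤ 6 (edges-delete v∈U) ⟩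
      6 * (edges V V + 2 * deg U v)           ≡⟨ *-distribˡ-+ 6 (edges V V) _ ⟩
      6 * edges V V + 6 * (2 * deg U v)       ≤⟨ +-mono-≤ (ih x ∣V∣ 3k≤2x) (*-monoʳ-≤ 6 (<⇒≤ low)) ⟩
      19 * (k * x) + 6 * (3 * k)              ≤⟨ ≤-by k (regroup k x) ⟩
      19 * (k * suc x)                        ∎
      where
      open ≤-Reasoning
      V = U ─ ⁅ v ⁆
      ∣V∣ : ∣ V ∣ ≡ k + x
      ∣V∣ = suc-injective (trans (cong (_+ ∣ V ∣) (sym (∣⁅x⁆∣≡1 v)))
              (trans (sym (∣∣-split (split-one v∈U))) (trans ∣U∣ (+-suc k x))))
      regroup : ∀ k x → 19 * (k * x) + 6 * (3 * k) + k ≡ 19 * (k * suc x)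
      regroup = solve-∀

    edge-bound-separate : ∀ {U} (sep : Separation k U) → let open Separation sep in
      ∣ B ∣ ≤ ∣ A ∣ → 2 * k ≤ ∣ A ∣ + ∣ B ∣ → (∀ {v} → v ∈ U → 3 * k ≤ 2 * deg U v) →
      (∀ V → ∣ V ∣ < ∣ U ∣ → EdgeBound V) → 6 * edges U U ≤ 19 * (k * (∣ A ∣ + ∣ B ∣))
    edge-bound-separate {U} sep B≤A 2k≤ large-deg ih = begin
      6 * edges U U                       ≡⟨ cong (6 *_) edges-T+B ⟩
      6 * (edges T T + E)                 ≤⟨ by-size (≤-total (3 * k) (2 * ∣ A ∣)) ⟩
      19 * (k * (∣ A ∣ + ∣ B ∣))          ∎
      where
      open Separation sep
      open Separation (flip sep) using () renaming (T to Z; U=T+B to U=Z+A; T=S+A to Z=S+B; ∣T∣ to ∣Z∣)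
      open ≤-Reasoning
      -- E and N count the adjacent and non-adjacent ordered pairs of B ∪ S that meet B; pairs
      -- inside S are counted with T.
      E = edges B B + 2 * edges B S
      N = non-edges B B + 2 * non-edges B S
      E+N : E + N ≡ ∣ B ∣ * ∣ B ∣ + 2 * (∣ B ∣ * k)
      E+N = begin-equality
        E + N
          ≡⟨ regroup (edges B B) (edges B S) (non-edges B B) (non-edges B S) ⟩
        edges B B + non-edges B B + 2 * (edges B S + non-edges B S)
          ≡⟨ cong₂ (λ x y → x + 2 * y) (edges+non-edges B B) (trans (edges+non-edges B S) (cong (∣ B ∣ *_) ∣S∣≡k)) ⟩
        ∣ B ∣ * ∣ B ∣ + 2 * (∣ B ∣ * k) ∎
        where
        regroup : ∀ a b c d → a + 2 * b + (c + 2 * d) ≡ a + c + 2 * (b + d)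
        regroup = solve-∀
      -- No neighbour of a vertex of B lies in A, so its degree in U is its degree in Z = S ∪ B.
      N≥ : ∀ β → ∣ B ∣ ≡ k + β → k * β ≤ N
      N≥ β ∣B∣ = side-non-edges separate Z=S+B ∣S∣≡k ∣B∣ λ {v} v∈B → begin
        3 * k                       ≤⟨ large-deg (∈-splitʳ U=T+B v∈B) ⟩
        2 * deg U v                 ≡⟨ cong (2 *_) (∑-split U=Z+A _) ⟩
        2 * (deg Z v + deg A v)     ≡⟨ cong (λ x → 2 * (deg Z v + x)) (deg-apart (apart-sym apart) v∈B) ⟩
        2 * (deg Z v + 0)           ≡⟨ cong (2 *_) (+-identityʳ (deg Z v)) ⟩
        2 * deg Z v                 ∎
      E≤ : E ≤ edges Z Z
      E≤ = begin
        edges B B + 2 * edges B S                     ≤⟨ m≤n+m _ (edges S S) ⟩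
        edges S S + (edges B B + 2 * edges B S)       ≡⟨ regroup (edges S S) (edges B B) (edges B S) ⟩
        edges S S + 2 * edges B S + edges B B         ≡⟨ cong (λ x → edges S S + 2 * x + edges B B) (pairs-comm _ ~-sym B S) ⟩
        edges S S + 2 * edges S B + edges B B         ≡⟨ pairs-square _ ~-sym Z=S+B ⟨
        edges Z Z                                     ∎
        where
        regroup : ∀ a b c → a + (b + 2 * c) ≡ a + 2 * c + b
        regroup = solve-∀
      side : 3 * k ≤ 2 * ∣ B ∣ ⊎ 2 * ∣ B ∣ ≤ 3 * k → 6 * E ≤ 19 * (k * ∣ B ∣)
      side (inj₁ 3k≤2b) = ≤-trans (*-monoʳ-≤ 6 E≤)
        (ih Z (subst (∣ Z ∣ <_) (sym (∣∣-split U=Z+A)) (m<m+n ∣ Z ∣ 0<∣A∣)) ∣ B ∣ ∣Z∣ 3k≤2b)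
      side (inj₂ 2b≤3k) = side-bound {k} {∣ B ∣} {E} {N} E+N N≥ 2b≤3k
      by-size : 3 * k ≤ 2 * ∣ A ∣ ⊎ 2 * ∣ A ∣ ≤ 3 * k → 6 * (edges T T + E) ≤ 19 * (k * (∣ A ∣ + ∣ B ∣))
      by-size (inj₁ 3k≤2a) = begin
        6 * (edges T T + E)                       ≡⟨ *-distribˡ-+ 6 (edges T T) E ⟩
        6 * edges T T + 6 * E
          ≤⟨ +-mono-≤ (ih T (subst (∣ T ∣ <_) (sym (∣∣-split U=T+B)) (m<m+n ∣ T ∣ 0<∣B∣)) ∣ A ∣ ∣T∣ 3k≤2a)
                      (side (≤-total (3 * k) (2 * ∣ B ∣))) ⟩
        19 * (k * ∣ A ∣) + 19 * (k * ∣ B ∣)       ≡⟨ regroup k ∣ A ∣ ∣ B ∣ ⟩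
        19 * (k * (∣ A ∣ + ∣ B ∣))                ∎
        where
        regroup : ∀ k a b → 19 * (k * a) + 19 * (k * b) ≡ 19 * (k * (a + b))
        regroup = solve-∀
      by-size (inj₂ 2a≤3k) = short-bound {k} {∣ A ∣} {∣ B ∣} {edges T T} {E} {N}
        (matula-edge-bound T ∣ A ∣ ∣T∣) E+N N≥ B≤A 2k≤ 2a≤3k

    edge-bound-bounded : ∀ m U → ∣ U ∣ ≤ m → EdgeBound U
    edge-bound-bounded m U U≤m x ∣U∣≡ 3k≤2x with ≤-<-connex x (2 * k)
    ... | inj₁ x≤2k = base-bound {k} {x} {edges U U} (matula-edge-bound U x ∣U∣≡) 3k≤2x x≤2k
    edge-bound-bounded zero U U≤0 x ∣U∣≡ 3k≤2x | inj₂ 2k<x =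
      contradiction (≤-trans (≤-trans (<-≤-trans (s≤s z≤n) 2k<x) (≤-trans (m≤n+m x k) (≤-reflexive (sym ∣U∣≡)))) U≤0) λ ()
    edge-bound-bounded (suc m) U U≤m (suc x) ∣U∣≡ 3k≤2x | inj₂ 2k<x
      with U⁺ , U⁻ , d , high , low ← split-by (λ v → 3 * k ≤? 2 * deg U v) U
      with ∣ U⁻ ∣ in ∣U⁻∣
    ... | suc _ with v , v∈U⁻ ← nonempty {p = U⁻} (subst (1 ≤_) (sym ∣U⁻∣) (s≤s z≤n)) =
      edge-bound-delete v∈U (≰⇒> (low v∈U⁻)) (edge-bound-bounded m (U ─ ⁅ v ⁆) V≤m) x ∣U∣≡
        -- From 2k < x + 1 follows 4k ≤ 2x, so the set without v is still in the range of the
        -- induction.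
        (≤-trans (*-monoˡ-≤ k (s≤s (s≤s (s≤s (z≤n {1}))))) (≤-trans (≤-reflexive (*-assoc 2 2 k)) (*-monoʳ-≤ 2 (s≤s⁻¹ 2k<x))))
      where
      v∈U = ∈-splitʳ d v∈U⁻
      V≤m : ∣ U ─ ⁅ v ⁆ ∣ ≤ m
      V≤m = s≤s⁻¹ (≤-trans (≤-reflexive (trans (cong (_+ ∣ U ─ ⁅ v ⁆ ∣) (sym (∣⁅x⁆∣≡1 v))) (sym (∣∣-split (split-one v∈U))))) U≤m)
    ... | zero =
      subst (λ y → 6 * edges U U ≤ 19 * (k * y)) (sym x≡)
        (edge-bound-separate sep (proj₂ balanced) (subst (2 * k ≤_) x≡ (<⇒≤ 2k<x)) large-deg
          λ V V<U → edge-bound-bounded m V (s≤s⁻¹ (≤-trans V<U U≤m)))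
      where
      k+2≤U : k + 2 ≤ ∣ U ∣
      -- Here k ≥ 2 enters: 2 ≤ k ≤ 2k ≤ x + 1 gives the size that a separation requires.
      k+2≤U = ≤-trans (+-monoʳ-≤ k (≤-trans 2≤k (≤-trans (m≤m+n k _) (<⇒≤ 2k<x)))) (≤-reflexive (sym ∣U∣≡))
      balanced = separate-balanced separate U k+2≤U
      sep = proj₁ balanced
      open Separation sep
      x≡ : suc x ≡ ∣ A ∣ + ∣ B ∣
      x≡ = +-cancelˡ-≡ k _ _ (trans (sym ∣U∣≡) ∣U∣)
      large-deg : ∀ {v} → v ∈ U → 3 * k ≤ 2 * deg U v
      large-deg v∈U with ∈-split⁻ d v∈U
      ... | inj₁ v∈U⁺ = high v∈U⁺
      ... | inj₂ v∈U⁻ = contradiction v∈U⁻ (empty⇒∉ ∣U⁻∣)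

    edge-bound : ∀ U → EdgeBound U
    edge-bound U = edge-bound-bounded ∣ U ∣ U ≤-refl

  -- Deciding between a separation and high connectivity.

  walk-snoc : ∀ {W : Subset n} {E u v w} → Walk W E u v → E v w ≡ true → w ∈ W → Walk W E u w
  walk-snoc (here v∈W)      e w∈W = step v∈W e (here w∈W)
  walk-snoc (step u∈W e′ π) e w∈W = step u∈W e′ (walk-snoc π e w∈W)

  induced : Subset n → Subgraph G
  induced U = record
    { verts     = U
    ; edge      = λ i j → adj G i j ∧ (lookup U i ∧ lookup U j)
    ; edge-sym  = λ i j → cong₂ _∧_ (adj-sym G i j) (∧-comm (lookup U i) (lookup U j))
    ; edge-sub  = λ i j → ∧-conicalˡ _ _
    ; edge-ends = λ i j e → let both = ∧-conicalʳ (adj G i j) _ e in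
        lookup⇒[]= i U (∧-conicalˡ _ _ both) , lookup⇒[]= j U (∧-conicalʳ (lookup U i) _ both)
    }

  induced-edge : ∀ {U i j} → i ∈ U → j ∈ U → adj G i j ≡ true → edge (induced U) i j ≡ true
  induced-edge i∈U j∈U e = cong₂ _∧_ e (cong₂ _∧_ ([]=⇒lookup i∈U) ([]=⇒lookup j∈U))

  Disconnection : Subset n → Set
  Disconnection W = ∃ λ A → ∃ λ B → Split W A B × 1 ≤ ∣ A ∣ × 1 ≤ ∣ B ∣ × Apart A B

  -- R is the set of vertices known to be reachable from u.
  grow : ∀ {U W R Q u} m → W ⊆ U → ∣ Q ∣ ≤ m → Split W R Q → 1 ≤ ∣ R ∣ →
         (∀ {v} → v ∈ R → Walk W (edge (induced U)) u v) →
         Disconnection W ⊎ (∀ {v} → v ∈ W → Walk W (edge (induced U)) u v)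
  grow {U} {W} {R} {Q} {u} m W⊆U Q≤m d 0<R walks
    with ∣ Q ∣ in ∣Q∣
  ... | zero = inj₂ λ v∈W → [ walks , (λ v∈Q → contradiction v∈Q (empty⇒∉ ∣Q∣)) ]′ (∈-split⁻ d v∈W)
  grow {U} {W} {R} {Q} {u} (suc m) W⊆U (s≤s q≤m) d 0<R walks | suc q
    with any? (λ i → i ∈? R ×-dec any? (λ j → j ∈? Q ×-dec (adj G i j ≟ true)))
  ... | no ∄e = inj₁ (R , Q , d , 0<R , subst (1 ≤_) (sym ∣Q∣) (s≤s z≤n) ,
                      λ i∈R j∈Q → ¬-not λ e → ∄e (_ , i∈R , _ , j∈Q , e))
  ... | yes (i , i∈R , j , j∈Q , e)
    with R′ , W=R′+Q′ , R′=R+j ← split-assoc d (split-one j∈Q) =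
    grow m W⊆U Q′≤m W=R′+Q′ (≤-trans 0<R (≤-by _ (sym (∣∣-split R′=R+j)))) walks′
    where
    i∈W = ∈-splitˡ d i∈R
    j∈W = ∈-splitʳ d j∈Q
    Q′≤m : ∣ Q ─ ⁅ j ⁆ ∣ ≤ m
    Q′≤m = ≤-trans (≤-reflexive (suc-injective
      (trans (cong (_+ ∣ Q ─ ⁅ j ⁆ ∣) (sym (∣⁅x⁆∣≡1 j))) (trans (sym (∣∣-split (split-one j∈Q))) ∣Q∣)))) q≤m
    walks′ : ∀ {v} → v ∈ R′ → Walk W (edge (induced U)) u v
    walks′ v∈R′ with ∈-split⁻ R′=R+j v∈R′
    ... | inj₁ v∈R = walks v∈R
    ... | inj₂ v∈j rewrite x∈⁅y⁆⇒x≡y j v∈j = walk-snoc (walks i∈R) (induced-edge (W⊆U i∈W) (W⊆U j∈W) e) j∈W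

  connected? : ∀ {U W} → W ⊆ U → Disconnection W ⊎ Connected W (edge (induced U))
  connected? {U} {W} W⊆U with search-Fin reach
    where
    reach : ∀ u → Disconnection W ⊎ (u ∈ W → ∀ {v} → v ∈ W → Walk W (edge (induced U)) u v)
    reach u with u ∈? W
    ... | no u∉W  = inj₂ λ u∈W → contradiction u∈W u∉W
    ... | yes u∈W = [ inj₁ , (λ walks → inj₂ λ _ → walks) ]′
      (grow ∣ W ∣ W⊆U (≤-by ∣ ⁅ u ⁆ ∣ (trans (+-comm ∣ W ─ ⁅ u ⁆ ∣ _) (sym (∣∣-split (split-one u∈W))))) (split-one u∈W)
        (≤-reflexive (sym (∣⁅x⁆∣≡1 u))) λ v∈u → subst (Walk W _ u) (sym (x∈⁅y⁆⇒x≡y u v∈u)) (here u∈W))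
  ... | inj₁ (_ , disconnection) = inj₁ disconnection
  ... | inj₂ walks               = inj₂ λ u v u∈W v∈W → walks u u∈W v∈W

  -- Only connectivity after deletion needs a search over S; that two vertices remain follows from
  -- ∣U∣ ≥ k + 2 by counting.
  succConnected? : ∀ k U → k + 2 ≤ ∣ U ∣ → Separation k U ⊎ SuccConnected k (induced U)
  succConnected? k U k+2≤U with search-Subset deletion
    where
    deletion : ∀ S → Separation k U ⊎ (S ⊆ U → ∣ S ∣ ≡ k → Connected (U ─ S) (edge (induced U)))
    deletion S with S ⊆? U | ∣ S ∣ ℕ.≟ k
    ... | no S⊈U | _ = inj₂ λ S⊆U → contradiction (λ {x} → S⊆U {x}) S⊈U
    ... | yes _  | no ∣S∣≢k = inj₂ λ _ ∣S∣≡k → contradiction ∣S∣≡k ∣S∣≢k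
    ... | yes S⊆U | yes ∣S∣≡k with connected? (∈-splitʳ (split-⊆ U S S⊆U))
    ...   | inj₂ connected = inj₂ λ _ _ → connected
    ...   | inj₁ (A , B , d , 0<A , 0<B , apart) = inj₁ record
      { splitᵁ = split-⊆ U S S⊆U ; splitᵂ = d ; ∣S∣≡k = ∣S∣≡k ; 0<∣A∣ = 0<A ; 0<∣B∣ = 0<B ; apart = apart }
  ... | inj₁ (_ , separation) = inj₁ separation
  ... | inj₂ connected        = inj₂ (k+2≤U , λ S S⊆U ∣S∣≡k → connected S S⊆U ∣S∣≡k ,
      +-cancelˡ-≤ k _ _ (≤-trans k+2≤U (≤-reflexive (trans (∣∣-split (split-⊆ U S S⊆U)) (cong (_+ ∣ U ─ S ∣) ∣S∣≡k)))))

  -- From the edge count to ordered pairs.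

  upward? : (p : Fin n × Fin n) → Dec (toℕ (proj₁ p) < toℕ (proj₂ p) × Bool.T (adj G (proj₁ p) (proj₂ p)))
  upward? p = (toℕ (proj₁ p) <? toℕ (proj₂ p)) ×-dec T? (adj G (proj₁ p) (proj₂ p))

  -- The indicator of the condition filtered in `edgeCount`; its symmetrisation is the adjacency
  -- indicator, whence the factor 2.
  upward : Fin n → Fin n → ℕ
  upward i j = if does (upward? (i , j)) then 1 else 0

  upward-< : ∀ {i j} → toℕ i < toℕ j → upward i j ≡ [ i ~ j ]
  upward-< {i} {j} i<j = cong (λ b → if b ∧ adj G i j then 1 else 0) (dec-true (toℕ i <? toℕ j) i<j)

  upward-≮ : ∀ {i j} → ¬ (toℕ i < toℕ j) → upward i j ≡ 0
  upward-≮ {i} {j} i≮j = cong (λ b → if b ∧ adj G i j then 1 else 0) (dec-false (toℕ i <? toℕ j) i≮j)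

  ~≡upward : ∀ i j → [ i ~ j ] ≡ upward i j + upward j i
  ~≡upward i j with <-cmp (toℕ i) (toℕ j)
  ... | tri< i<j _ j≮i = sym (trans (cong₂ _+_ (upward-< i<j) (upward-≮ j≮i)) (+-identityʳ _))
  ... | tri> i≮j _ j<i = sym (trans (cong₂ _+_ (upward-≮ i≮j) (upward-< j<i)) (~-sym j i))
  ... | tri≈ i≮j i≡j j≮i = trans (loop (toℕ-injective i≡j)) (sym (cong₂ _+_ (upward-≮ i≮j) (upward-≮ j≮i)))
    where
    loop : ∀ {i j} → i ≡ j → [ i ~ j ] ≡ 0
    loop {i} refl = cong (if_then 1 else 0) (adj-irrefl G i)

  2*edgeCount : 2 * edgeCount G ≡ edges ⊤ ⊤
  2*edgeCount = begin
    2 * edgeCount G                            ≡⟨ cong (2 *_) count ⟩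
    2 * pairs upward ⊤ ⊤                       ≡⟨ cong (pairs upward ⊤ ⊤ +_) (trans (+-identityʳ _) (∑-swap upward ⊤ ⊤)) ⟩
    pairs upward ⊤ ⊤ + pairs (λ i j → upward j i) ⊤ ⊤
      ≡⟨ ∑-+ (⊤ {n}) (λ i → ∑ ⊤ (upward i)) (λ i → ∑ ⊤ (λ j → upward j i)) ⟨
    ∑ ⊤ (λ i → ∑ ⊤ (upward i) + ∑ ⊤ (λ j → upward j i))
      ≡⟨ ∑-cong {p = ⊤} (λ {i} _ → trans (sym (∑-+ ⊤ (upward i) (λ j → upward j i))) (∑-cong {p = ⊤ {n}} λ {j} _ → sym (~≡upward i j))) ⟩
    edges ⊤ ⊤                                  ∎
    where
    open ≡-Reasoning
    count : edgeCount G ≡ pairs upward ⊤ ⊤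
    count = trans (length-filter-product upward? (λ i → i) (allFin n))
                  (∑-cong {p = ⊤} λ {i} _ → length-filter-tabulate (upward? ∘ (i ,_)) (λ j → j))

theorem2 : (k : ℕ) → 2 ≤ k → (n : ℕ) → (G : Graph n) →
    5 * k ≤ 2 * n →
    19 * (k * (n ∸ k)) < 12 * edgeCount G →
    Σ (Subgraph G) (λ H → SuccConnected k H)
theorem2 k 2≤k n G 5k≤2n many-edges = [ (λ (U , connected) → induced U , connected) , too-few-edges ]′ (search-Subset classify)
  where
  open OfGraph G

  classify : ∀ U → SuccConnected k (induced U) ⊎ (k + 2 ≤ ∣ U ∣ → Separation k U)
  classify U with k + 2 ≤? ∣ U ∣
  ... | no k+2≰U  = inj₂ λ k+2≤U → contradiction k+2≤U k+2≰U
  ... | yes k+2≤U = [ (λ sep → inj₂ λ _ → sep) , inj₁ ]′ (succConnected? k U k+2≤U)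

  open ≤-Reasoning
  -- Makes the truncated `n ∸ k` a true difference.
  k≤n : k ≤ n
  k≤n = *-cancelˡ-≤ 2 (≤-trans (*-monoˡ-≤ k (s≤s (s≤s (z≤n {3})))) 5k≤2n)

  k+[n∸k] : k + (n ∸ k) ≡ n
  k+[n∸k] = m+[n∸m]≡n k≤n

  -- In terms of x = n - k, the hypothesis n ≥ 5k/2 is the lower end x ≥ 3k/2 of the edge bound's
  -- range.
  3k≤2x : 3 * k ≤ 2 * (n ∸ k)
  3k≤2x = +-cancelˡ-≤ (2 * k) _ _ (begin
    2 * k + 3 * k           ≡⟨ *-distribʳ-+ k 2 3 ⟨
    5 * k                   ≤⟨ 5k≤2n ⟩
    2 * n                   ≡⟨ cong (2 *_) k+[n∸k] ⟨
    2 * (k + (n ∸ k))       ≡⟨ *-distribˡ-+ 2 k (n ∸ k) ⟩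
    2 * k + 2 * (n ∸ k)     ∎)

  too-few-edges : (∀ U → k + 2 ≤ ∣ U ∣ → Separation k U) → Σ (Subgraph G) (SuccConnected k)
  too-few-edges separate = contradiction many-edges (≤⇒≯ (begin
    12 * edgeCount G            ≡⟨ *-assoc 6 2 (edgeCount G) ⟩
    6 * (2 * edgeCount G)       ≡⟨ cong (6 *_) 2*edgeCount ⟩
    6 * edges ⊤ ⊤               ≤⟨ edge-bound 2≤k separate ⊤ (n ∸ k) (trans (∣⊤∣≡n n) (sym k+[n∸k])) 3k≤2x ⟩
    19 * (k * (n ∸ k))          ∎))
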